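{- Let $G$ be a doubly-connected graph of order $n\ge 4$ and let $\overline G$ be its complement. Then $2\le\beta(G)+\beta(\overline G)\le 2n-6$. Moreover: (i) $\beta(G)+\beta(\overline G)=2$ if and only if $G=P_4$; (ii) $\beta(G)+\beta(\overline G)=2n-6$ if and only if $G\in\Omega_1\cup\Omega_2\cup\Omega_3$, where $\Omega_1=\{P_4,C_5,B\}$, $\Omega_2=\{P_4[K_{n-3}^{(1)}],\ P_4[\overline K_{n-3}^{(1)}],\ P_4[K_{n-3}^{(2)}],\ P_4[\overline K_{n-3}^{(2)}]\}$, $\Omega_3=\{P_4[K_r^{(1)},K_{n-r-2}^{(2)}]:1\le r\le n-3\}\cup\{P_4[\overline K_r^{(1)},\overline K_{n-r-2}^{(3)}]:1\le r\le n-3\}$. (Equality and membership are up to isomorphism.)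
   Context: Graphs are finite, simple and undirected. A graph $G$ is doubly-connected if both $G$ and its complement $\overline G$ are connected. For a connected graph $G=(V,E)$ with distance $d$, a set $D=\{x_1,\dots,x_k\}\subseteq V$ is a locating set if the vectors $(d(v,x_1),\dots,d(v,x_k))$, $v\in V$, are pairwise distinct; the location number (metric dimension) $\beta(G)$ is the minimum cardinality of a locating set. $K_m$, $\overline K_m$, $C_m$, $P_m$ denote the complete graph, edgeless graph, cycle and path on $m$ vertices. The bull graph $B$ is the 5-vertex graph obtained from a triangle by attaching one pendant vertex to each of two distinct vertices of the triangle. The vertices of $P_4$ are labelled $1,2,3,4$ consecutively along the path (edges $12,23,34$). For a graph $\Gamma$ with vertices labelled by integers, $\Gamma[H^{(i)}]$ denotes the graph obtained from $\Gamma$ by replacing vertex $i$ by the graph $H$ and joining every vertex of $H$ to every neighbor of $i$ in $\Gamma$. Similarly, $\Gamma[H_1^{(i)},H_2^{(j)}]$ ($i\neq j$) is the graph obtained from $\Gamma$ by replacing vertex $i$ by $H_1$ and vertex $j$ by $H_2$, joining every vertex of $H_1$ (resp. $H_2$) to every remaining neighbor of $i$ (resp. $j$) in $\Gamma$, and, exactly when $ij$ is an edge of $\Gamma$, also joining every vertex of $H_1$ to every vertex of $H_2$. -}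

module Defs where

open import Data.Bool using (if_then_else_)
open import Data.Empty using (⊥)
open import Data.Fin using (Fin; toℕ)
open import Data.Fin.Patterns using (0F; 1F; 2F; 3F; 4F)
open import Data.Fin.Properties using (_≟_; any?; all?)
open import Data.Fin.Subset using (Subset; _∈_; ∣_∣; ⊤)
open import Data.Fin.Subset.Properties using (_∈?_; anySubset?; ∈⊤)
open import Data.List using (List; []; _∷_)
import Data.List.Membership.DecPropositional as DecList
open import Data.Nat as ℕ using (ℕ; zero; suc; NonZero; _∸_; _≤_; z≤n; s≤s; _%_)
open import Data.Nat.Properties using (n≤0⇒n≡0)
open import Data.Product using (Σ; ∃; ∃-syntax; _×_; _,_; proj₁; proj₂)
open import Data.Product.Properties using (≡-dec)
open import Data.Sum using (_⊎_; swap)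
open import Function using (_∘_; _↔_; _⇔_; Inverse)
open import Level using (0ℓ)
open import Relation.Binary using (Rel; Symmetric; Irreflexive; Decidable)
open import Relation.Binary.PropositionalEquality
  using (_≡_; _≢_; refl; trans; subst; ≢-sym)
open import Relation.Nullary using (yes; no; ¬_; does; contradiction)
open import Relation.Nullary.Decidable using (map′; ¬?; _×-dec_; _⊎-dec_; _→-dec_)
open import Relation.Unary as U using (Pred)

record Graph (V : Set) : Set₁ where
  field
    Adj    : Rel V 0ℓ
    adj?   : Decidable Adj
    symm   : Symmetric Adj
    irrefl : Irreflexive _≡_ Adj

open Graph public

record _≅_ {V W : Set} (G : Graph V) (H : Graph W) : Set where
  field
    bijection : V ↔ W
    adj-iff   : ∀ u v → Adj G u v ⇔ Adj H (Inverse.to bijection u) (Inverse.to bijection v)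

infix 4 _≅_

complement : ∀ {n} → Graph (Fin n) → Graph (Fin n)
complement G = record
  { Adj    = λ u v → u ≢ v × ¬ Adj G u v
  ; adj?   = λ u v → ¬? (u ≟ v) ×-dec ¬? (adj? G u v)
  ; symm   = λ (u≢v , ¬uv) → ≢-sym u≢v , ¬uv ∘ symm G
  ; irrefl = λ u≡v (u≢v , _) → u≢v u≡v
  }

data Walk {V : Set} (G : Graph V) : V → ℕ → V → Set where
  []  : ∀ {u} → Walk G u 0 u
  _∷_ : ∀ {u w v k} → Adj G u w → Walk G w k v → Walk G u (suc k) v

Connected : ∀ {V} → Graph V → Set
Connected G = ∀ u v → ∃[ k ] Walk G u k v

record DoublyConnected {n} (G : Graph (Fin n)) : Set where
  field
    connected            : Connected G
    complement-connected : Connected (complement G)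

IsLeast : Pred ℕ 0ℓ → Pred ℕ 0ℓ
IsLeast P k = P k × (∀ j → P j → k ≤ j)

least : ∀ {P : Pred ℕ 0ℓ} → U.Decidable P → ∃ P → ∃ (IsLeast P)
least {P} P? (n , p) = search P? n p
  where
  search : ∀ {Q : Pred ℕ 0ℓ} → U.Decidable Q → ∀ m → Q m → ∃ (IsLeast Q)
  search Q? zero    q = 0 , q , λ _ _ → z≤n
  search Q? (suc m) q with Q? 0
  ... | yes q₀ = 0 , q₀ , λ _ _ → z≤n
  ... | no ¬q₀ with search (Q? ∘ suc) m q
  ...   | k , qk , min = suc k , qk , λ where
            zero    q₀ → contradiction q₀ ¬q₀
            (suc j) qj → s≤s (min j qj)

walk? : ∀ {n} (G : Graph (Fin n)) u v → U.Decidable (λ k → Walk G u k v)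
walk? G u v zero    = map′ (λ where refl → []) (λ where [] → refl) (u ≟ v)
walk? G u v (suc k) =
  map′ (λ (_ , a , w) → a ∷ w) (λ where (a ∷ w) → _ , a , w)
       (any? λ x → adj? G u x ×-dec walk? G x v k)

module _ {n} (G : Graph (Fin n)) (c : Connected G) where

  shortest : ∀ u v → ∃ (IsLeast (λ k → Walk G u k v))
  shortest u v = least (walk? G u v) (c u v)

  dist : Fin n → Fin n → ℕ
  dist u v = proj₁ (shortest u v)

  Locating : Subset n → Set
  Locating D = ∀ u v → (∀ x → x ∈ D → dist u x ≡ dist v x) → u ≡ v

  locating? : U.Decidable Locating
  locating? D = all? λ u → all? λ v →
    (all? λ x → (x ∈? D) →-dec (dist u x ℕ.≟ dist v x)) →-dec (u ≟ v)

  dist≡0⇒≡ : ∀ u v → dist u v ≡ 0 → u ≡ v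
  dist≡0⇒≡ u v d≡0
    with [] ← subst (λ k → Walk G u k v) d≡0 (proj₁ (proj₂ (shortest u v))) = refl

  dist-refl : ∀ u → dist u u ≡ 0
  dist-refl u = n≤0⇒n≡0 (proj₂ (proj₂ (shortest u u)) 0 [])

  locating-⊤ : Locating ⊤
  locating-⊤ u v same = dist≡0⇒≡ u v (trans (same v ∈⊤) (dist-refl v))

  HasLocatingSetOfSize : Pred ℕ 0ℓ
  HasLocatingSetOfSize k = ∃[ D ] ∣ D ∣ ≡ k × Locating D

  minimumLocating : ∃ (IsLeast HasLocatingSetOfSize)
  minimumLocating = least (λ k → anySubset? λ D → (∣ D ∣ ℕ.≟ k) ×-dec locating? D)
                          (∣ ⊤ {n} ∣ , ⊤ , refl , locating-⊤)

  β : ℕ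
  β = proj₁ minimumLocating

fromRel : ∀ {n} {R : Rel (Fin n) 0ℓ} → Decidable R → Graph (Fin n)
fromRel {R = R} R? = record
  { Adj    = λ u v → u ≢ v × (R u v ⊎ R v u)
  ; adj?   = λ u v → ¬? (u ≟ v) ×-dec (R? u v ⊎-dec R? v u)
  ; symm   = λ (u≢v , r) → ≢-sym u≢v , swap r
  ; irrefl = λ u≡v (u≢v , _) → u≢v u≡v
  }

K : ∀ m → Graph (Fin m)
K m = record
  { Adj    = _≢_
  ; adj?   = λ u v → ¬? (u ≟ v)
  ; symm   = ≢-sym
  ; irrefl = λ u≡v u≢v → u≢v u≡v
  }

K̄ : ∀ m → Graph (Fin m)
K̄ m = record
  { Adj    = λ _ _ → ⊥
  ; adj?   = λ _ _ → no λ ()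
  ; symm   = λ ()
  ; irrefl = λ _ ()
  }

P : ∀ m → Graph (Fin m)
P m = fromRel λ u v → toℕ v ℕ.≟ suc (toℕ u)

-- A cycle only for m ≥ 3.
C : ∀ m .{{_ : NonZero m}} → Graph (Fin m)
C m = fromRel λ u v → toℕ v ℕ.≟ suc (toℕ u) % m

-- Triangle 0, 1, 2 with pendant vertices 3 (at 0) and 4 (at 1).
bullEdges : List (Fin 5 × Fin 5)
bullEdges = (0F , 1F) ∷ (1F , 2F) ∷ (0F , 2F) ∷ (0F , 3F) ∷ (1F , 4F) ∷ []

B : Graph (Fin 5)
B = fromRel λ u v → (u , v) DecPair.∈? bullEdges
  where module DecPair = DecList (≡-dec (_≟_ {5}) (_≟_ {5}))

FinGraph : Set₁
FinGraph = ∃[ m ] Graph (Fin m)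

module _ {k} (Γ : Graph (Fin k)) (H : Fin k → FinGraph) where

  ReplacedVertex : Set
  ReplacedVertex = Σ (Fin k) λ i → Fin (proj₁ (H i))

  data ReplacedAdj : Rel ReplacedVertex 0ℓ where
    outer : ∀ {i j a b} → Adj Γ i j → ReplacedAdj (i , a) (j , b)
    inner : ∀ {i a b} → Adj (proj₂ (H i)) a b → ReplacedAdj (i , a) (i , b)

  replacedAdj? : Decidable ReplacedAdj
  replacedAdj? (i , a) (j , b) with adj? Γ i j
  ... | yes ij = yes (outer ij)
  ... | no ¬ij with i ≟ j
  ...   | no i≢j   = no λ where
                       (outer ij) → ¬ij ij
                       (inner _)  → i≢j refl
  ...   | yes refl = map′ inner
                       (λ where
                         (outer ij) → contradiction ij ¬ij
                         (inner ab) → ab)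
                       (adj? (proj₂ (H i)) a b)

  replaceAll : Graph ReplacedVertex
  replaceAll = record
    { Adj    = ReplacedAdj
    ; adj?   = replacedAdj?
    ; symm   = λ where
        (outer ij) → outer (symm Γ ij)
        (inner ab) → inner (symm (proj₂ (H _)) ab)
    ; irrefl = λ where
        refl (outer ii) → irrefl Γ refl ii
        refl (inner aa) → irrefl (proj₂ (H _)) refl aa
    }

-- A vertex that is not replaced is the same as one replaced by K 1.
at : ∀ {k m} → Fin k → Graph (Fin m) → Fin k → FinGraph
at i H l = if does (l ≟ i) then (_ , H) else (1 , K 1)

-- Meant for distinct i and j.
at₂ : ∀ {k m₁ m₂} → Fin k → Graph (Fin m₁) → Fin k → Graph (Fin m₂) → Fin k → FinGraph
at₂ i H₁ j H₂ l = if does (l ≟ i) then (_ , H₁) else at j H₂ l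

_[_⟨_⟩] : ∀ {k m} (Γ : Graph (Fin k)) (H : Graph (Fin m)) (i : Fin k) →
          Graph (ReplacedVertex Γ (at i H))
Γ [ H ⟨ i ⟩] = replaceAll Γ (at i H)

_[_⟨_⟩,_⟨_⟩] : ∀ {k m₁ m₂} (Γ : Graph (Fin k))
               (H₁ : Graph (Fin m₁)) (i : Fin k) (H₂ : Graph (Fin m₂)) (j : Fin k) →
               Graph (ReplacedVertex Γ (at₂ i H₁ j H₂))
Γ [ H₁ ⟨ i ⟩, H₂ ⟨ j ⟩] = replaceAll Γ (at₂ i H₁ j H₂)

-- Membership is up to isomorphism.  The vertex of P 4 usually labelled i (1 ≤ i ≤ 4)
-- is the element i − 1 of Fin 4.

Ω₁ Ω₂ Ω₃ : ∀ {n} → Graph (Fin n) → Set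
Ω₁ G = G ≅ P 4 ⊎ G ≅ C 5 ⊎ G ≅ B
Ω₂ {n} G =
  G ≅ P 4 [ K (n ∸ 3) ⟨ 0F ⟩] ⊎
  G ≅ P 4 [ K̄ (n ∸ 3) ⟨ 0F ⟩] ⊎
  G ≅ P 4 [ K (n ∸ 3) ⟨ 1F ⟩] ⊎
  G ≅ P 4 [ K̄ (n ∸ 3) ⟨ 1F ⟩]
Ω₃ {n} G =
  (∃[ r ] 1 ≤ r × r ≤ n ∸ 3 × G ≅ P 4 [ K r ⟨ 0F ⟩, K (n ∸ r ∸ 2) ⟨ 1F ⟩]) ⊎
  (∃[ r ] 1 ≤ r × r ≤ n ∸ 3 × G ≅ P 4 [ K̄ r ⟨ 0F ⟩, K̄ (n ∸ r ∸ 2) ⟨ 2F ⟩])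

{-# OPTIONS --safe #-}

-- A doubly connected graph contains an induced path a - b - c - d, and three suitable vertices
-- near it are always resolved by the remaining ones, so β(G) and β(Ḡ) are at most n - 3.
--
-- If both equal n - 3, then no four vertices are resolved by the remaining ones, in G or in Ḡ.
-- This is tested on an induced path and two further vertices x, y.  Adjacency and common
-- neighbours show some distances 1 and 2; more distances are known once it is shown, from weaker
-- forms of the same test, that the ends of an induced path have no common neighbour.  A finite
-- computation then leaves only pairs x, y which extend the path to a blow-up of P₄, so that in G
-- or in Ḡ two nonadjacent vertices b, d have the property that b is adjacent to all other vertices,
-- which are independent.  A single further vertex x allows in addition the pentagon and the bull.
--
-- If β(G) = β(Ḡ) = 1, then some vertex has degree at most 2 in G and at most 1 in Ḡ, whence n ≤ 4.

module Submission where

open import Data.Bool using (Bool; true; false; T; not; _∧_; _∨_; if_then_else_)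
import Data.Bool.Properties as Bool
open import Data.Bool.Properties using (T?)
open import Data.Empty using (⊥; ⊥-elim)
open import Data.Fin as F using (Fin; zero; suc; inject≤; punchIn; fromℕ<)
open import Data.Fin.Patterns using (0F; 1F; 2F; 3F; 4F; 5F)
open import Data.Fin.Permutation using (↔⇒≡)
open import Data.Fin.Properties
  using (_≟_; any?; all?; <-cmp; ¬∀⟶∃¬; inject≤-injective; injective⇒≤; suc-injective; pigeonhole;
         punchIn-injective; punchInᵢ≢i)
open import Data.Fin.Subset as S using (Subset; _∈_; _⊃_; ∣_∣; _-_; ∁; inside; outside)
open import Data.Fin.Subset.Induction using (⊃-wellFounded; Acc; acc)
open import Data.Fin.Subset.Properties
  using (_∈?_; ∈⊤; ∣⊤∣≡n; x∈p∧x≢y⇒x∈p-y; x∈p⇒∣p-x∣<∣p∣; ∣∁p∣≡n∸∣p∣; x∈∁p⇒x∉p; x∉p⇒x∈∁p;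
         p─⊥≡p; p─q⊆p)
open import Data.Nat using (ℕ; zero; suc; _+_; _*_; _∸_; _≤_; _<_; z≤n; s≤s)
import Data.Nat.Properties as ℕ
open import Data.Nat.Tactic.RingSolver using (solve-∀)
open import Data.Product using (∃; ∃₂; _×_; _,_; proj₁; proj₂)
open import Data.Sum using (_⊎_; inj₁; inj₂; [_,_]′)
open import Data.Unit using (⊤; tt)
open import Data.Vec using (Vec; []; _∷_; here; there; lookup; tabulate; allFin)
open import Data.Vec.Properties using (lookup⇒[]=; []=⇒lookup; lookup∘tabulate; lookup-allFin)
import Data.Vec.Relation.Unary.All.Properties as All
open import Data.Vec.Relation.Unary.All using ([]; _∷_)
open import Data.Vec.Relation.Unary.AllPairs using (AllPairs; []; _∷_)
open import Data.Vec.Relation.Unary.Unique.Propositional.Properties using (lookup-injective)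
open import Function using (_∘_; _$_; id; Injective; Inverse; _⇔_; mk⇔; Equivalence; mk↔ₛ′)
open import Relation.Binary using (tri<; tri≈; tri>)
open import Relation.Binary.PropositionalEquality
  using (_≡_; _≢_; refl; sym; trans; cong; cong₂; subst; subst₂; ≢-sym)
open import Relation.Nullary using (¬_; Dec; yes; no; does; contradiction)
open import Relation.Nullary.Decidable
  using (_→-dec_; _×-dec_; _⊎-dec_; ¬?; decidable-stable; map′; from-yes; dec-true; dec-false;
         does-⇔)
open import Defs

-- Locating sets and distances

-- Six vertices are four to be resolved and two to resolve them. The obstacle is that the adjacency
-- of six vertices does not determine their distances, since a shortest path may leave the six.
-- Distance 1, and distance 2 through a common neighbour among the six, are certain; of any other
-- pair it is only known that the distance is at least 2, which tells it apart from 1 and from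
-- nothing else. Separating 2 from 3 takes a statement about the whole graph, that the ends of an
-- induced path have no common neighbour anywhere, and this statement is itself drawn from the test.
-- The circle is broken by three strengths of the test. `never` assumes no such statement, `local`
-- assumes it for paths which another of the six vertices certifies, and `always` assumes it for
-- every induced path, which is justified from n = 6 on. Each strength is proved sound by means of
-- the weaker ones. Since this has to hold in a graph and in its complement, the two are carried
-- along as a symmetric pair.

remove : ∀ {n k} → (Fin k → Fin n) → Subset n
remove {k = zero}  X = S.⊤
remove {k = suc _} X = remove (X ∘ suc) - X zero

∈-remove : ∀ {n k} (X : Fin k → Fin n) {v} → (∀ i → X i ≢ v) → v ∈ remove X
∈-remove {k = zero}  X X≢v = ∈⊤
∈-remove {k = suc _} X X≢v =
  x∈p∧x≢y⇒x∈p-y (∈-remove (X ∘ suc) (X≢v ∘ suc)) (≢-sym (X≢v zero))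

∣remove∣ : ∀ {n k} (X : Fin k → Fin n) → Injective _≡_ _≡_ X → ∣ remove X ∣ + k ≤ n
∣remove∣ {n} {zero}  X inj = ℕ.≤-reflexive (trans (ℕ.+-identityʳ _) (∣⊤∣≡n n))
∣remove∣ {n} {suc k} X inj = begin
  ∣ remove X ∣ + suc k         ≡⟨ ℕ.+-suc _ k ⟩
  suc ∣ remove X ∣ + k         ≤⟨ ℕ.+-monoˡ-≤ k (x∈p⇒∣p-x∣<∣p∣ X₀∈) ⟩
  ∣ remove (X ∘ suc) ∣ + k     ≤⟨ ∣remove∣ (X ∘ suc) (suc-injective ∘ inj) ⟩
  n                            ∎
  where
  open ℕ.≤-Reasoning
  X₀∈ : X zero ∈ remove (X ∘ suc)
  X₀∈ = ∈-remove (X ∘ suc) λ i eq → contradiction (inj eq) λ ()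

enum : ∀ {n} (p : Subset n) → Fin ∣ p ∣ → Fin n
enum (inside  ∷ p) zero    = zero
enum (inside  ∷ p) (suc i) = suc (enum p i)
enum (outside ∷ p) i       = suc (enum p i)

enum-injective : ∀ {n} (p : Subset n) → Injective _≡_ _≡_ (enum p)
enum-injective (inside  ∷ p) {zero}  {zero}  eq = refl
enum-injective (inside  ∷ p) {suc _} {suc _} eq = cong suc (enum-injective p (suc-injective eq))
enum-injective (outside ∷ p) eq = enum-injective p (suc-injective eq)

enum-∈ : ∀ {n} (p : Subset n) i → enum p i ∈ p
enum-∈ (inside  ∷ p) zero    = here
enum-∈ (inside  ∷ p) (suc i) = there (enum-∈ p i)
enum-∈ (outside ∷ p) i       = there (enum-∈ p i)

enum-surjective : ∀ {n} (p : Subset n) {v} → v ∈ p → ∃ λ i → enum p i ≡ v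
enum-surjective (inside  ∷ p) here = zero , refl
enum-surjective (inside  ∷ p) (there v∈p) =
  let i , eq = enum-surjective p v∈p in suc i , cong suc eq
enum-surjective (outside ∷ p) (there v∈p) =
  let i , eq = enum-surjective p v∈p in i , cong suc eq

module _ {n} (G : Graph (Fin n)) (c : Connected G) where

  dist-walk : ∀ u v → Walk G u (dist G c u v) v
  dist-walk u v = proj₁ (proj₂ (shortest G c u v))

  dist-min : ∀ {u v k} → Walk G u k v → dist G c u v ≤ k
  dist-min w = proj₂ (proj₂ (shortest G c _ _)) _ w

  dist≥2 : ∀ {u v} → u ≢ v → ¬ Adj G u v → 2 ≤ dist G c u v
  dist≥2 {u} {v} u≢v ¬uv = long (dist-walk u v)
    where
    long : ∀ {k} → Walk G u k v → 2 ≤ k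
    long []            = contradiction refl u≢v
    long (uv ∷ [])     = contradiction uv ¬uv
    long (_ ∷ (_ ∷ _)) = s≤s (s≤s z≤n)

  dist≥3 : ∀ {u v} → u ≢ v → ¬ Adj G u v → (∀ z → Adj G u z → ¬ Adj G v z) → 3 ≤ dist G c u v
  dist≥3 {u} {v} u≢v ¬uv ¬common = long (dist-walk u v)
    where
    long : ∀ {k} → Walk G u k v → 3 ≤ k
    long []                  = contradiction refl u≢v
    long (uv ∷ [])           = contradiction uv ¬uv
    long (uz ∷ (zv ∷ []))    = contradiction (symm G zv) (¬common _ uz)
    long (_ ∷ (_ ∷ (_ ∷ _))) = s≤s (s≤s (s≤s z≤n))

  adj⇒dist≡1 : ∀ {u v} → Adj G u v → dist G c u v ≡ 1
  adj⇒dist≡1 {u} {v} uv = ℕ.≤-antisym (dist-min (uv ∷ []))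
    (ℕ.n≢0⇒n>0 λ d≡0 → irrefl G (dist≡0⇒≡ G c u v d≡0) uv)

  common⇒dist≡2 : ∀ {u v z} → u ≢ v → ¬ Adj G u v → Adj G u z → Adj G v z → dist G c u v ≡ 2
  common⇒dist≡2 u≢v ¬uv uz vz =
    ℕ.≤-antisym (dist-min (uz ∷ (symm G vz ∷ []))) (dist≥2 u≢v ¬uv)

  -- One-sided on purpose: it yields an inequality of distances, and complementation turns it round.
  Twins : Fin n → Fin n → Set
  Twins u v = ∀ w → w ≢ u → w ≢ v → Adj G u w → Adj G v w

  -- A walk from `u` to `x` becomes one from `v` by changing its first step. If that step leads to
  -- `v` itself, dropping it leaves a shorter walk.
  twins⇒dist≤ : ∀ {u v x} → Twins u v → x ≢ u → dist G c v x ≤ dist G c u x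
  twins⇒dist≤ {u} {v} {x} tw x≢u = go (dist-walk u x)
    where
    go : ∀ {k} → Walk G u k x → dist G c v x ≤ k
    go [] = contradiction refl x≢u
    go (_∷_ {w = w} uw p) with w ≟ v
    ... | yes refl = ℕ.≤-trans (dist-min p) (ℕ.n≤1+n _)
    ... | no w≢v = dist-min (tw w (λ w≡u → irrefl G (sym w≡u) uw) w≢v uw ∷ p)

  twins⇒dist≡ : ∀ {u v x} → Twins u v → Twins v u → x ≢ u → x ≢ v → dist G c u x ≡ dist G c v x
  twins⇒dist≡ uv vu x≢u x≢v = ℕ.≤-antisym (twins⇒dist≤ vu x≢v) (twins⇒dist≤ uv x≢u)

  -- The witness avoids all of `X`, so it is still available once `X` is removed from the locating
  -- set.
  Resolved : ∀ {k} → (Fin k → Fin n) → Fin k → Fin k → Set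
  Resolved X i j = ∃ λ x → (∀ l → X l ≢ x) × dist G c (X i) x ≢ dist G c (X j) x

  ResolvedOutside : ∀ {k} → (Fin k → Fin n) → Set
  ResolvedOutside X = ∀ i j → i F.< j → Resolved X i j

  resolved-≢ : ∀ {k} {X : Fin k → Fin n} → ResolvedOutside X → ∀ {i j} → i ≢ j → Resolved X i j
  resolved-≢ res {i} {j} i≢j with <-cmp i j
  ... | tri< i<j _ _ = res i j i<j
  ... | tri≈ _ i≡j _ = contradiction i≡j i≢j
  ... | tri> _ _ j<i = let x , x∉X , d≢ = res j i j<i in x , x∉X , ≢-sym d≢

  resolved⇒injective : ∀ {k} {X : Fin k → Fin n} → ResolvedOutside X → Injective _≡_ _≡_ X
  resolved⇒injective res {i} {j} Xi≡Xj = decidable-stable (i ≟ j) λ i≢j →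
    let x , _ , d≢ = resolved-≢ res i≢j in d≢ (cong (λ u → dist G c u x) Xi≡Xj)

  β-min : ∀ D → Locating G c D → β G c ≤ ∣ D ∣
  β-min D loc = proj₂ (proj₂ (minimumLocating G c)) _ (D , refl , loc)

  -- A remaining vertex resolves itself from all others, as only its own distance is 0. Hence only
  -- pairs inside `X` need a witness.
  resolved⇒locating : ∀ {k} {X : Fin k → Fin n} → ResolvedOutside X → Locating G c (remove X)
  resolved⇒locating {X = X} res u v same with any? (λ i → X i ≟ u) | any? (λ j → X j ≟ v)
  ... | no ¬u | _ = sym (dist≡0⇒≡ G c v u
    (trans (sym (same u (∈-remove X (λ i eq → ¬u (i , eq))))) (dist-refl G c u)))
  ... | yes _ | no ¬v = dist≡0⇒≡ G c u v
    (trans (same v (∈-remove X (λ i eq → ¬v (i , eq)))) (dist-refl G c v))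
  ... | yes (i , refl) | yes (j , refl) with i ≟ j
  ...   | yes i≡j = cong X i≡j
  ...   | no i≢j  = let x , x∉X , d≢ = resolved-≢ res i≢j in
                    contradiction (same x (∈-remove X x∉X)) d≢

  resolved⇒β+k≤n : ∀ {k} (X : Fin k → Fin n) → ResolvedOutside X → β G c + k ≤ n
  resolved⇒β+k≤n {k} X res =
    ℕ.≤-trans (ℕ.+-monoˡ-≤ k (β-min _ (resolved⇒locating res)))
              (∣remove∣ X (resolved⇒injective res))

  locating⇒resolved : ∀ {D} → Locating G c D → ∀ {u v} → u ≢ v →
                      ∃ λ x → x ∈ D × dist G c u x ≢ dist G c v x
  locating⇒resolved {D} loc {u} {v} u≢v =
    let x , ¬same = ¬∀⟶∃¬ n _ (λ x → (x ∈? D) →-dec (dist G c u x ℕ.≟ dist G c v x))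
                               (u≢v ∘ loc u v) in
    x , decidable-stable (x ∈? D) (λ x∉D → ¬same λ x∈D → contradiction x∈D x∉D)
      , λ d≡ → ¬same λ _ → d≡

  minimum : ∃ λ D → ∣ D ∣ ≡ β G c × Locating G c D
  minimum = proj₁ (proj₂ (minimumLocating G c))

  NoneResolved : ℕ → Set
  NoneResolved k = ∀ (X : Fin k → Fin n) → ¬ ResolvedOutside X

  -- Otherwise a minimum locating set leaves out at least k vertices, and any k of these are
  -- resolved by it, hence from outside.
  noneResolved⇒n<β+k : ∀ {k} → NoneResolved k → n < β G c + k
  noneResolved⇒n<β+k {k} none = ℕ.≰⇒> λ β+k≤n →
    let D , ∣D∣≡β , loc = minimum
        k≤ : k ≤ ∣ ∁ D ∣
        k≤ = subst (k ≤_) (sym (trans (∣∁p∣≡n∸∣p∣ D) (cong (n ∸_) ∣D∣≡β)))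
               (ℕ.m+n≤o⇒m≤o∸n k (subst (_≤ n) (ℕ.+-comm _ k) β+k≤n))
        X = λ i → enum (∁ D) (inject≤ i k≤)
        X∉D = λ i → x∈∁p⇒x∉p (enum-∈ (∁ D) (inject≤ i k≤))
    in none X λ i j i<j →
      let x , x∈D , d≢ = locating⇒resolved loc {X i} {X j}
                 (λ eq → ℕ.<⇒≢ i<j (cong F.toℕ
                   (inject≤-injective k≤ k≤ i j (enum-injective (∁ D) eq))))
      in x , (λ l Xl≡x → X∉D l (subst (_∈ D) (sym Xl≡x) x∈D)) , d≢

  n<β+4⇒noneResolved : n < β G c + 4 → NoneResolved 4
  n<β+4⇒noneResolved n<β+4 X res = ℕ.<⇒≱ n<β+4 (resolved⇒β+k≤n X res)

  Resolver : Fin n → Set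
  Resolver x = ∀ {u v} → dist G c u x ≡ dist G c v x → u ≡ v

  β≢0 : 2 ≤ n → β G c ≢ 0
  β≢0 (s≤s (s≤s z≤n)) β≡0 =
    let D , ∣D∣≡β , loc = minimum
        x , x∈D , _ = locating⇒resolved loc {zero} {suc zero} λ ()
        i , _ = enum-surjective D x∈D
    in ¬Fin0 (subst Fin (trans ∣D∣≡β β≡0) i)
    where
    ¬Fin0 : ¬ Fin 0
    ¬Fin0 ()

  β≡1⇒resolver : 2 ≤ n → β G c ≡ 1 → ∃ Resolver
  β≡1⇒resolver (s≤s (s≤s z≤n)) β≡1 =
    let D , ∣D∣≡β , loc = minimum
        x , x∈D , _ = locating⇒resolved loc {zero} {suc zero} λ ()
        i , ix = enum-surjective D x∈D
    in x , λ {u} {v} d≡ → loc u v λ y y∈D →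
      let j , jy = enum-surjective D y∈D
          x≡y = trans (sym ix) (trans (cong (enum D) (Fin1 (trans ∣D∣≡β β≡1) i j)) jy)
      in subst (λ y → dist G c u y ≡ dist G c v y) x≡y d≡
    where
    Fin1 : ∀ {m} → m ≡ 1 → (i j : Fin m) → i ≡ j
    Fin1 refl zero zero = refl

-- Induced paths in doubly connected graphs

select : ∀ {n} {P : Fin n → Set} → (∀ v → Dec (P v)) → Subset n
select P? = tabulate (does ∘ P?)

∈-select⁺ : ∀ {n} {P : Fin n → Set} (P? : ∀ v → Dec (P v)) {v} → P v → v ∈ select P?
∈-select⁺ P? {v} pv = lookup⇒[]= v _ (trans (lookup∘tabulate _ v) (dec-true (P? v) pv))

∈-select⁻ : ∀ {n} {P : Fin n → Set} (P? : ∀ v → Dec (P v)) {v} → v ∈ select P? → P v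
∈-select⁻ P? {v} v∈ = decidable-stable (P? v) λ ¬pv →
  contradiction (trans (sym (dec-false (P? v) ¬pv))
                       (trans (sym (lookup∘tabulate _ v)) ([]=⇒lookup v∈))) λ ()

record InducedP₄ {V : Set} (G : Graph V) (a b c d : V) : Set where
  constructor p₄
  field
    ab : Adj G a b
    bc : Adj G b c
    cd : Adj G c d
    ¬ac : ¬ Adj G a c
    ¬ad : ¬ Adj G a d
    ¬bd : ¬ Adj G b d

-- The complement as a relation between two graphs, so that they can be exchanged: complementing
-- twice restores adjacency only up to equivalence, not the same `Graph`.
record Opposite {V : Set} (A B : Graph V) : Set where
  field
    to   : ∀ {u v} → u ≢ v → ¬ Adj A u v → Adj B u v
    from : ∀ {u v} → Adj B u v → ¬ Adj A u v

opposite-sym : ∀ {V} {A B : Graph V} → Opposite A B → Opposite B A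
opposite-sym {A = A} opp = record
  { to   = λ u≢v ¬uv → decidable-stable (adj? A _ _) (¬uv ∘ to u≢v)
  ; from = λ uv uv′ → from uv′ uv
  }
  where open Opposite opp

complement-opposite : ∀ {n} (G : Graph (Fin n)) → Opposite G (complement G)
complement-opposite G = record { to = _,_ ; from = proj₂ }

inducedP₄? : ∀ {V} (G : Graph V) a b c d → Dec (InducedP₄ G a b c d)
inducedP₄? G a b c d =
  map′ (λ (ab , bc , cd , ¬ac , ¬ad , ¬bd) → p₄ ab bc cd ¬ac ¬ad ¬bd)
       (λ (p₄ ab bc cd ¬ac ¬ad ¬bd) → ab , bc , cd , ¬ac , ¬ad , ¬bd)
       (adj? G a b ×-dec adj? G b c ×-dec adj? G c d
        ×-dec ¬? (adj? G a c) ×-dec ¬? (adj? G a d) ×-dec ¬? (adj? G b d))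

adj⇒≢ : ∀ {V} (G : Graph V) {u v} → Adj G u v → u ≢ v
adj⇒≢ G uv u≡v = irrefl G u≡v uv

neighbour : ∀ {V} {G : Graph V} → Connected G → ∀ {u v} → u ≢ v → ∃ (Adj G u)
neighbour c {u} {v} u≢v with c u v
... | _ , []       = contradiction refl u≢v
... | _ , (uw ∷ _) = _ , uw

module _ {n} {A B : Graph (Fin n)} (cA : Connected A) (cB : Connected B) (opp : Opposite A B)
         (P₄-free : ∀ {a b c d} → ¬ InducedP₄ A a b c d) (v : Fin n) where
  open Opposite opp

  Friend Stranger : Fin n → Set
  Friend u = Adj A v u
  Stranger w = w ≢ v × ¬ Adj A v w

  -- Otherwise u′ - v - u - w is an induced path. So friends joined by a walk of friends in the
  -- complement see the same strangers.
  cofellows : ∀ {u u′ w} → Friend u → Friend u′ → Stranger w → u ≢ u′ → ¬ Adj A u u′ →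
              Adj A u w → Adj A u′ w
  cofellows {u} {u′} {w} vu vu′ (_ , ¬vw) u≢u′ ¬uu′ uw = decidable-stable (adj? A u′ w) λ ¬u′w →
    P₄-free (p₄ (symm A vu′) vu uw (¬uu′ ∘ symm A) ¬u′w ¬vw)

  -- Otherwise v - u - w - w′ is an induced path. So a friend sees a component of the strangers
  -- entirely or not at all.
  fellows : ∀ {u w w′} → Friend u → Stranger w → Stranger w′ → Adj A w w′ → Adj A u w → Adj A u w′
  fellows {u} {w} {w′} vu (_ , ¬vw) (_ , ¬vw′) ww′ uw = decidable-stable (adj? A u w′) λ ¬uw′ →
    P₄-free (p₄ vu uw ww′ ¬vw ¬vw′ ¬uw′)

  -- Follow a walk from `u` to `v` in the complement. As long as it stays among friends, `cofellows`
  -- preserves what is seen. No friend is adjacent to `v` there, so the walk must step to a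
  -- stranger, which its last friend misses, and with it `u`.
  missed : ∀ {u} → Friend u → ∃ λ w → Stranger w × ¬ Adj A u w
  missed {u} vu = go (λ _ uw → uw) vu (proj₂ (cB u v))
    where
    go : ∀ {x k} → (∀ {w} → Stranger w → Adj A u w → Adj A x w) → Friend x → Walk B x k v →
         ∃ λ w → Stranger w × ¬ Adj A u w
    go inv vx [] = contradiction vx (irrefl A refl)
    go {x} inv vx (_∷_ {w = y} xy p) with adj? A v y | y ≟ v
    ... | yes vy | _        =
      go (λ mw uw → cofellows vx vy mw (adj⇒≢ B xy) (from xy) (inv mw uw)) vy p
    ... | no ¬vy | yes refl = contradiction (symm A vx) (from xy)
    ... | no ¬vy | no y≢v   = y , (y≢v , ¬vy) , from xy ∘ inv (y≢v , ¬vy)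

  -- Dually, a walk from `w` to `v` in `A` must enter a friend; this friend sees the last stranger
  -- before it and, by `fellows`, also `w`.
  reached : ∀ {w} → Stranger w → ∃ λ u → Friend u × Adj A u w
  reached {w} mw = go (λ _ uw → uw) mw (proj₂ (cA w v))
    where
    go : ∀ {x k} → (∀ {u} → Friend u → Adj A u x → Adj A u w) → Stranger x → Walk A x k v →
         ∃ λ u → Friend u × Adj A u w
    go inv (x≢v , _) [] = contradiction refl x≢v
    go {x} inv mx@(_ , ¬vx) (_∷_ {w = y} xy p) with adj? A v y | y ≟ v
    ... | yes vy | _        = y , vy , inv vy (symm A xy)
    ... | no ¬vy | yes refl = contradiction (symm A xy) ¬vx
    ... | no ¬vy | no y≢v   = go (λ nu uy → inv nu (fellows nu my mx (symm A xy) uy)) my p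
      where my = y≢v , ¬vy

  Stranger? : ∀ w → Dec (Stranger w)
  Stranger? w = ¬? (w ≟ v) ×-dec ¬? (adj? A v w)

  reach? : ∀ u w → Dec (Stranger w × Adj A u w)
  reach? u w = Stranger? w ×-dec adj? A u w

  reach : Fin n → Subset n
  reach u = select (reach? u)

  -- Let u₁ ~ w₁ ≁ u.  If u₁ does not reach strictly more strangers than u does, then some stranger
  -- w is adjacent to u but not to u₁, and w, u, u₁, w₁ is an induced path.
  noNeighbour : ∀ {u} → Acc _⊃_ (reach u) → ¬ Friend u
  noNeighbour {u} (acc rec) vu with missed vu
  ... | w₁ , mw₁ , ¬uw₁ with reached mw₁
  ...   | u₁ , vu₁ , u₁w₁ with all? (λ w → reach? u w →-dec adj? A u₁ w)
  ...     | yes ⊆ = noNeighbour (rec (more , w₁ , ∈-select⁺ (reach? u₁) (mw₁ , u₁w₁)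
                                      , ¬uw₁ ∘ proj₂ ∘ ∈-select⁻ (reach? u))) vu₁
    where
    more : reach u S.⊆ reach u₁
    more x∈ = let mx , ux = ∈-select⁻ (reach? u) x∈ in ∈-select⁺ (reach? u₁) (mx , ⊆ _ (mx , ux))
  ...     | no ⊈ with ¬∀⟶∃¬ n _ (λ w → reach? u w →-dec adj? A u₁ w) ⊈
  ...       | w , ¬r with decidable-stable (reach? u w) (λ ¬uw → ¬r λ uw → contradiction uw ¬uw)
  ...         | mw , uw = P₄-free (p₄ (symm A uw) uu₁ u₁w₁ (¬u₁w ∘ symm A) ¬ww₁ ¬uw₁)
    where
    ¬u₁w : ¬ Adj A u₁ w
    ¬u₁w u₁w = ¬r λ _ → u₁w
    uu₁ : Adj A u u₁
    uu₁ = decidable-stable (adj? A u u₁) λ ¬uu₁ →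
      ¬uw₁ (cofellows vu₁ vu mw₁ (λ { refl → ¬uw₁ u₁w₁ }) (¬uu₁ ∘ symm A) u₁w₁)
    ¬ww₁ : ¬ Adj A w w₁
    ¬ww₁ ww₁ = ¬uw₁ (fellows vu mw mw₁ ww₁ uw)

-- The classical fact that a P₄-free graph with at least two vertices is disconnected or has a
-- disconnected complement. Connectedness gives `zero` a neighbour, which `noNeighbour` forbids.
∃-inducedP₄ : ∀ {n} {A B : Graph (Fin n)} → 2 ≤ n → Connected A → Connected B → Opposite A B →
              ∃ λ a → ∃ λ b → ∃ λ c → ∃ λ d → InducedP₄ A a b c d
∃-inducedP₄ {A = A} (s≤s (s≤s z≤n)) cA cB opp =
  decidable-stable (any? λ a → any? λ b → any? λ c → any? λ d → inducedP₄? A a b c d) λ ¬p →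
    let u , vu = neighbour {G = A} cA {zero} {suc zero} λ ()
    in noNeighbour cA cB opp (λ p → ¬p (_ , _ , _ , _ , p)) zero (⊃-wellFounded _) vu

-- Bounds on the location number

module _ {V : Set} {G : Graph V} {a b c d : V} (p : InducedP₄ G a b c d) where
  open InducedP₄ p

  a≢b : a ≢ b
  a≢b = adj⇒≢ G ab
  b≢c : b ≢ c
  b≢c = adj⇒≢ G bc
  c≢d : c ≢ d
  c≢d = adj⇒≢ G cd
  a≢c : a ≢ c
  a≢c refl = ¬ad cd
  a≢d : a ≢ d
  a≢d refl = ¬ac (symm G cd)
  b≢d : b ≢ d
  b≢d refl = ¬ad ab

  reverse : InducedP₄ G d c b a
  reverse = p₄ (symm G cd) (symm G bc) (symm G ab) (¬bd ∘ symm G) (¬ad ∘ symm G) (¬ac ∘ symm G)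

-- The complement of a - b - c - d is b - d - a - c.
opposite-P₄ : ∀ {V} {A B : Graph V} {a b c d : V} → Opposite A B →
              InducedP₄ A a b c d → InducedP₄ B b d a c
opposite-P₄ {A = A} {B} opp p =
  p₄ (to (b≢d p) ¬bd) (symm B (to (a≢d p) ¬ad)) (to (a≢c p) ¬ac)
     (λ ba → from ba (symm A ab)) (λ b~c → from b~c bc) (λ dc → from dc (symm A cd))
  where
  open InducedP₄ p
  open Opposite opp

module _ {n} (G : Graph (Fin n)) (conn : Connected G) where

  near≢far : ∀ {u v x} → Adj G u x → v ≢ x → ¬ Adj G v x → dist G conn u x ≢ dist G conn v x
  near≢far ux v≢x ¬vx d≡ =
    ℕ.<⇒≢ (dist≥2 G conn v≢x ¬vx) (trans (sym (adj⇒dist≡1 G conn ux)) d≡)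

  resolve₃ : ∀ {p q r} → (∃ λ x → p ≢ x × q ≢ x × r ≢ x × dist G conn p x ≢ dist G conn q x)
                       → (∃ λ x → p ≢ x × q ≢ x × r ≢ x × dist G conn p x ≢ dist G conn r x)
                       → (∃ λ x → p ≢ x × q ≢ x × r ≢ x × dist G conn q x ≢ dist G conn r x)
                       → ResolvedOutside G conn (lookup (p ∷ q ∷ r ∷ []))
  resolve₃ (x , px , qx , rx , d≢) _ _ 0F 1F _ = x , (λ { 0F → px ; 1F → qx ; 2F → rx }) , d≢
  resolve₃ _ (x , px , qx , rx , d≢) _ 0F 2F _ = x , (λ { 0F → px ; 1F → qx ; 2F → rx }) , d≢
  resolve₃ _ _ (x , px , qx , rx , d≢) 1F 2F _ = x , (λ { 0F → px ; 1F → qx ; 2F → rx }) , d≢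
  resolve₃ _ _ _ 0F 0F ()
  resolve₃ _ _ _ 1F 0F ()
  resolve₃ _ _ _ 1F 1F (s≤s ())
  resolve₃ _ _ _ 2F 0F ()
  resolve₃ _ _ _ 2F 1F (s≤s ())
  resolve₃ _ _ _ 2F 2F (s≤s (s≤s ()))

  resolve-increasing : ∀ {p q r s x} → p ≢ x → q ≢ x → r ≢ x → s ≢ x →
                       dist G conn p x < dist G conn q x → dist G conn q x < dist G conn r x →
                       dist G conn r x < dist G conn s x →
                       ResolvedOutside G conn (lookup (p ∷ q ∷ r ∷ s ∷ []))
  resolve-increasing {p} {q} {r} {s} {x} p≢x q≢x r≢x s≢x pq qr rs = λ
    { 0F 1F _ → x , ∉X , ℕ.<⇒≢ pq
    ; 0F 2F _ → x , ∉X , ℕ.<⇒≢ (ℕ.<-trans pq qr)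
    ; 0F 3F _ → x , ∉X , ℕ.<⇒≢ (ℕ.<-trans pq (ℕ.<-trans qr rs))
    ; 1F 2F _ → x , ∉X , ℕ.<⇒≢ qr
    ; 1F 3F _ → x , ∉X , ℕ.<⇒≢ (ℕ.<-trans qr rs)
    ; 2F 3F _ → x , ∉X , ℕ.<⇒≢ rs
    ; 0F 0F ()
    ; (suc _) 0F ()
    ; (suc _) 1F (s≤s ())
    ; (suc (suc _)) 2F (s≤s (s≤s ()))
    ; 3F 3F (s≤s (s≤s (s≤s ())))
    }
    where
    ∉X : ∀ l → lookup (p ∷ q ∷ r ∷ s ∷ []) l ≢ x
    ∉X 0F = p≢x
    ∉X 1F = q≢x
    ∉X 2F = r≢x
    ∉X 3F = s≢x

  -- If a and d have no common neighbour, then b, c, d are at distances 1, 2 and at least 3 from a.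
  -- If they have a common neighbour x not adjacent to c, then a still separates b from c and d, and
  -- x separates c from d. If x is adjacent to c, the triple is a, b, x: c separates a from b, and d
  -- separates x from both.
  P₄⇒resolved : ∀ {a b c d} → InducedP₄ G a b c d → ∃ λ X → ResolvedOutside G conn {3} X
  P₄⇒resolved {a} {b} {c} {d} p with any? (λ x → adj? G d x ×-dec adj? G a x)
  ... | no ¬x = lookup (b ∷ c ∷ d ∷ []) , resolve₃
    (a , ≢-sym (a≢b p) , ≢-sym (a≢c p) , ≢-sym (a≢d p) ,
      near≢far (symm G ab) (≢-sym (a≢c p)) (¬ac ∘ symm G))
    (a , ≢-sym (a≢b p) , ≢-sym (a≢c p) , ≢-sym (a≢d p) ,
      near≢far (symm G ab) (≢-sym (a≢d p)) (¬ad ∘ symm G))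
    (a , ≢-sym (a≢b p) , ≢-sym (a≢c p) , ≢-sym (a≢d p) ,
      λ d≡ → ℕ.<⇒≢ (dist≥3 G conn (≢-sym (a≢d p)) (¬ad ∘ symm G) (λ z dz az → ¬x (z , dz , az)))
                   (trans (sym (common⇒dist≡2 G conn (≢-sym (a≢c p)) (¬ac ∘ symm G)
                                             (symm G bc) ab)) d≡))
    where open InducedP₄ p
  ... | yes (x , dx , ax) with adj? G c x
  ...   | no ¬cx = lookup (b ∷ c ∷ d ∷ []) , resolve₃
    (a , ≢-sym (a≢b p) , ≢-sym (a≢c p) , ≢-sym (a≢d p) ,
      near≢far (symm G ab) (≢-sym (a≢c p)) (¬ac ∘ symm G))
    (a , ≢-sym (a≢b p) , ≢-sym (a≢c p) , ≢-sym (a≢d p) ,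
      near≢far (symm G ab) (≢-sym (a≢d p)) (¬ad ∘ symm G))
    (x , (λ { refl → ¬bd (symm G dx) }) , c≢x , adj⇒≢ G dx , ≢-sym (near≢far dx c≢x ¬cx))
    where
    open InducedP₄ p
    c≢x : c ≢ x
    c≢x refl = ¬ac ax
  ...   | yes cx = lookup (a ∷ b ∷ x ∷ []) , resolve₃
    (c , a≢c p , b≢c p , x≢c , ≢-sym (near≢far bc (a≢c p) ¬ac))
    (d , a≢d p , b≢d p , x≢d , ≢-sym (near≢far (symm G dx) (a≢d p) ¬ad))
    (d , a≢d p , b≢d p , x≢d , ≢-sym (near≢far (symm G dx) (b≢d p) ¬bd))
    where
    open InducedP₄ p
    x≢c : x ≢ c
    x≢c refl = ¬ac ax
    x≢d : x ≢ d
    x≢d = ≢-sym (adj⇒≢ G dx)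

  P₄⇒β+3≤n : ∀ {a b c d} → InducedP₄ G a b c d → β G conn + 3 ≤ n
  P₄⇒β+3≤n p = let X , res = P₄⇒resolved p in resolved⇒β+k≤n G conn X res

  -- Distances to a resolving vertex differ by one along an edge, so G is a path starting at x.
  resolver⇒degree≤1 : ∀ {x} → Resolver G conn x → ∀ {u v} → Adj G u x → Adj G v x → u ≡ v
  resolver⇒degree≤1 res ux vx = res (trans (adj⇒dist≡1 G conn ux) (sym (adj⇒dist≡1 G conn vx)))

  -- `f` tells whether a neighbour of `y` is nearer to `x` than `y` is or farther away; each side
  -- holds at most one.
  resolver⇒degree≤2 : ∀ {x} → Resolver G conn x → ∀ y → ∃ λ (f : Fin n → Fin 2) →
                      ∀ {u v} → Adj G u y → Adj G v y → f u ≡ f v → u ≡ v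
  resolver⇒degree≤2 {x} res y = f , λ uy vy → f-inj _ _ uy vy
    where
    D : Fin n → ℕ
    D u = dist G conn u x
    f : Fin n → Fin 2
    f u with D u ℕ.<? D y
    ... | yes _ = 0F
    ... | no _  = 1F
    step : ∀ {u v} → Adj G u v → D u ≤ suc (D v)
    step {u} {v} uv = dist-min G conn (uv ∷ dist-walk G conn v x)
    below : ∀ {u} → Adj G u y → D u < D y → suc (D u) ≡ D y
    below uy lt = ℕ.≤-antisym lt (step (symm G uy))
    above : ∀ {u} → Adj G u y → ¬ (D u < D y) → D u ≡ suc (D y)
    above uy ≮ = ℕ.≤-antisym (step uy)
      (ℕ.≤∧≢⇒< (ℕ.≮⇒≥ ≮) λ eq → irrefl G (res (sym eq)) uy)
    f-inj : ∀ u v → Adj G u y → Adj G v y → f u ≡ f v → u ≡ v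
    f-inj u v uy vy eq with D u ℕ.<? D y | D v ℕ.<? D y
    ... | yes u< | yes v< = res (ℕ.suc-injective (trans (below uy u<) (sym (below vy v<))))
    ... | no u≮  | no v≮  = res (trans (above uy u≮) (sym (above vy v≮)))
    f-inj u v uy vy () | yes _ | no _
    f-inj u v uy vy () | no _ | yes _

resolvers⇒n≤4 : ∀ {n} {A B : Graph (Fin n)} (cA : Connected A) (cB : Connected B) → Opposite A B →
                ∀ {x y} → Resolver A cA x → Resolver B cB y → n ≤ 4
resolvers⇒n≤4 {n} {A} {B} cA cB opp {x} {y} rx ry = injective⇒≤ {f = g} (λ {u} {v} → g-inj u v)
  where
  open Opposite opp
  f = proj₁ (resolver⇒degree≤2 A cA rx y)
  f-inj = proj₂ (resolver⇒degree≤2 A cA rx y)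
  g : Fin n → Fin 4
  -- 0 is for `y`, 1 for its only possible neighbour in `B`, and 2 and 3 for those in `A`.
  g u with u ≟ y | adj? A u y
  ... | yes _ | _     = 0F
  ... | no _  | no _  = 1F
  ... | no _  | yes _ = suc (suc (f u))
  g-inj : ∀ u v → g u ≡ g v → u ≡ v
  g-inj u v eq with u ≟ y | adj? A u y | v ≟ y | adj? A v y
  ... | yes u≡y | _     | yes v≡y | _     = trans u≡y (sym v≡y)
  ... | no u≢y | no ¬uy | no v≢y | no ¬vy = resolver⇒degree≤1 B cB ry (to u≢y ¬uy) (to v≢y ¬vy)
  ... | no _ | yes uy | no _ | yes vy = f-inj uy vy (suc-injective (suc-injective eq))
  g-inj u v () | yes _ | _ | no _ | yes _
  g-inj u v () | yes _ | _ | no _ | no _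
  g-inj u v () | no _ | yes _ | yes _ | _
  g-inj u v () | no _ | no _ | yes _ | _
  g-inj u v () | no _ | no _ | no _ | yes _
  g-inj u v () | no _ | yes _ | no _ | no _

-- Types of the vertices outside an induced path

data Code : Set where
  near two three far : Code

-- far is used when nothing better than "at least 2" is known.
Means : Code → ℕ → Set
Means near  d = d ≡ 1
Means two   d = d ≡ 2
Means three d = 3 ≤ d
Means far   d = 2 ≤ d

classify : {P Q R : Set} → Dec P → Dec Q → Dec R → Code
classify p? q? r? =
  if does p? then near else if does q? then two else if does r? then three else far

classify-means : ∀ {P Q R : Set} {d} (p? : Dec P) (q? : Dec Q) (r? : Dec R) →
  (P → d ≡ 1) → (¬ P → Q → d ≡ 2) → (¬ P → R → 3 ≤ d) → (¬ P → 2 ≤ d) → Means (classify p? q? r?) d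
classify-means (yes p) _       _       d≡1 _   _   _   = d≡1 p
classify-means (no ¬p) (yes q) _       _   d≡2 _   _   = d≡2 ¬p q
classify-means (no ¬p) (no _)  (yes r) _   _   3≤d _   = 3≤d ¬p r
classify-means (no ¬p) (no _)  (no _)  _   _   _   2≤d = 2≤d ¬p

-- `far` is apart from `near` only, since it leaves every distance from 2 on possible.
data Apart : Code → Code → Set where
  near-two   : Apart near two
  near-three : Apart near three
  near-far   : Apart near far
  two-near   : Apart two near
  two-three  : Apart two three
  three-near : Apart three near
  three-two  : Apart three two
  far-near   : Apart far near

apart? : ∀ p q → Dec (Apart p q)
apart? near  near  = no λ ()
apart? near  two   = yes near-two
apart? near  three = yes near-three
apart? near  far   = yes near-far
apart? two   near  = yes two-near
apart? two   two   = no λ ()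
apart? two   three = yes two-three
apart? two   far   = no λ ()
apart? three near  = yes three-near
apart? three two   = yes three-two
apart? three three = no λ ()
apart? three far   = no λ ()
apart? far   near  = yes far-near
apart? far   two   = no λ ()
apart? far   three = no λ ()
apart? far   far   = no λ ()

apart⇒≢ : ∀ {p q d e} → Apart p q → Means p d → Means q e → d ≢ e
apart⇒≢ near-two   refl refl ()
apart⇒≢ near-three refl (s≤s ()) refl
apart⇒≢ near-far   refl (s≤s ()) refl
apart⇒≢ two-near   refl refl ()
apart⇒≢ two-three  refl (s≤s (s≤s ())) refl
apart⇒≢ three-near (s≤s ()) refl refl
apart⇒≢ three-two  (s≤s (s≤s ())) refl refl
apart⇒≢ far-near   (s≤s ()) refl refl

-- The resolution test on six vertices

Matrix : Set
Matrix = Fin 6 → Fin 6 → Bool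

Path : Matrix → (i j k l : Fin 6) → Set
Path M i j k l = T (M i j) × T (M j k) × T (M k l) × ¬ T (M i k) × ¬ T (M i l) × ¬ T (M j l)

path? : ∀ M i j k l → Dec (Path M i j k l)
path? M i j k l =
  T? _ ×-dec T? _ ×-dec T? _ ×-dec ¬? (T? _) ×-dec ¬? (T? _) ×-dec ¬? (T? _)

-- The adjacency of a vertex to a, b, c and d, in this order.
Type : Set
Type = Vec Bool 4

-- A vertex of such a type rules out a common neighbour of a and d, by excluded-shortcut below.
certifies : Type → Bool
certifies (za ∷ zb ∷ zc ∷ zd ∷ []) = not ((za ∧ zb) ∨ (zc ∧ zd) ∨ (za ∧ zd))

-- Cert M i j k l is the evidence demanded for the claim that the ends of the induced path
-- i - j - k - l have no common neighbour in the whole graph.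
record Rule : Set₁ where
  field
    Cert  : Matrix → (i j k l : Fin 6) → Set
    cert? : ∀ M i j k l → Dec (Cert M i j k l)
open Rule

never local always : Rule
never .Cert _ _ _ _ _  = ⊥
never .cert? _ _ _ _ _ = no λ ()
local .Cert M i j k l  = ∃ λ z → (z ≢ i × z ≢ j × z ≢ k × z ≢ l)
                               × T (certifies (M z i ∷ M z j ∷ M z k ∷ M z l ∷ []))
local .cert? M i j k l = any? λ z →
  (¬? (z ≟ i) ×-dec ¬? (z ≟ j) ×-dec ¬? (z ≟ k) ×-dec ¬? (z ≟ l)) ×-dec T? _
always .Cert _ _ _ _ _  = ⊤
always .cert? _ _ _ _ _ = yes tt

module _ (R : Rule) (M : Matrix) where

  -- Only `Remote` can speak about vertices beyond the six, through its certificate. The absence of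
  -- `Common` proves nothing about the graph.
  Common Remote : (i j : Fin 6) → Set
  Common i j = ∃ λ k → T (M i k) × T (M j k)
  Remote i l = ∃₂ λ j k → Path M i j k l × Cert R M i j k l

  common? : ∀ i j → Dec (Common i j)
  common? i j = any? λ k → T? (M i k) ×-dec T? (M j k)

  remote? : ∀ i j → Dec (Remote i j)
  remote? i l = any? λ j → any? λ k → path? M i j k l ×-dec cert? R M i j k l

  code : (i j : Fin 6) → Code
  code i j = classify (T? (M i j)) (common? i j) (remote? i j)

-- Tabulated so that the type checker computes each code once.
Codes : Set
Codes = Vec (Vec Code 6) 6

codes : Rule → Matrix → Codes
codes R M = tabulate λ i → tabulate (code R M i)

Split : Codes → (u v x : Fin 6) → Set
Split C u v x = Apart (lookup (lookup C u) x) (lookup (lookup C v) x)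

-- The indices left when the two resolving vertices `p` and `punchIn p q` are set aside.
others : Fin 6 → Fin 5 → Fin 4 → Fin 6
others p q i = punchIn p (punchIn q i)

-- A record, so that conversion checking compares the matrices and not their codes.
record Resolving (R : Rule) (M : Matrix) : Set where
  constructor resolving
  field
    p : Fin 6
    q : Fin 5
    splits : ∀ i j → i F.< j → Split (codes R M) (others p q i) (others p q j) p
                             ⊎ Split (codes R M) (others p q i) (others p q j) (punchIn p q)

resolving? : ∀ R M → Dec (Resolving R M)
resolving? R M = search (codes R M) refl
  where
  -- The table is passed as an argument so that all choices of `p` and `q` share it.
  search : ∀ C → C ≡ codes R M → Dec (Resolving R M)
  search C refl = map′ (λ (p , q , r) → resolving p q r) (λ (resolving p q r) → p , q , r)
    (any? λ p → any? λ q → all? λ i → all? λ j → (i F.<? j) →-dec (apart? _ _ ⊎-dec apart? _ _))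

Agrees : ∀ {n} → Matrix → Graph (Fin n) → (Fin 6 → Fin n) → Set
Agrees M G w = ∀ i j → M i j ≡ does (adj? G (w i) (w j))

-- A certificate read off the matrix must exclude every common neighbour `z`, also those outside the
-- six.
RuleSound : ∀ {n} → Rule → Graph (Fin n) → Set
RuleSound R G = ∀ (w : Fin 6 → Fin _) {M} → Injective _≡_ _≡_ w → Agrees M G w →
  ∀ {i j k l} → InducedP₄ G (w i) (w j) (w k) (w l) → Cert R M i j k l →
  ∀ {z} → Adj G (w i) z → Adj G (w l) z → ⊥

module _ {n} (G : Graph (Fin n)) (conn : Connected G) (none : NoneResolved G conn 4)
         {R : Rule} (sound : RuleSound R G)
         (w : Fin 6 → Fin n) (w-inj : Injective _≡_ _≡_ w) (M : Matrix) (agree : Agrees M G w) where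

  T⇒adj : ∀ {i j} → T (M i j) → Adj G (w i) (w j)
  T⇒adj {i} {j} t = decidable-stable (adj? G (w i) (w j)) λ ¬a →
    subst T (trans (agree i j) (dec-false (adj? G (w i) (w j)) ¬a)) t

  adj⇒T : ∀ {i j} → Adj G (w i) (w j) → T (M i j)
  adj⇒T {i} {j} a = subst T (sym (trans (agree i j) (dec-true (adj? G (w i) (w j)) a))) tt

  path⇒P₄ : ∀ {i j k l} → Path M i j k l → InducedP₄ G (w i) (w j) (w k) (w l)
  path⇒P₄ (ij , jk , kl , ¬ik , ¬il , ¬jl) =
    p₄ (T⇒adj ij) (T⇒adj jk) (T⇒adj kl) (¬ik ∘ adj⇒T) (¬il ∘ adj⇒T) (¬jl ∘ adj⇒T)

  code-means : ∀ {i j} → i ≢ j → Means (code R M i j) (dist G conn (w i) (w j))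
  code-means {i} {j} i≢j = classify-means (T? (M i j)) (common? R M i j) (remote? R M i j)
    (adj⇒dist≡1 G conn ∘ T⇒adj)
    (λ ¬ij (k , ik , jk) → common⇒dist≡2 G conn wi≢wj (¬ij ∘ adj⇒T) (T⇒adj ik) (T⇒adj jk))
    (λ ¬ij (_ , _ , path , cert) → dist≥3 G conn wi≢wj (¬ij ∘ adj⇒T)
       λ z wiz wjz → sound w w-inj agree (path⇒P₄ path) cert wiz wjz)
    (λ ¬ij → dist≥2 G conn wi≢wj (¬ij ∘ adj⇒T))
    where
    wi≢wj : w i ≢ w j
    wi≢wj = i≢j ∘ w-inj

  lookup-codes : ∀ i j → lookup (lookup (codes R M) i) j ≡ code R M i j
  lookup-codes i j = trans
    (cong (λ r → lookup r j) (lookup∘tabulate (λ i → tabulate (code R M i)) i))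
    (lookup∘tabulate (code R M i) j)

  split⇒dist≢ : ∀ {u v x} → u ≢ x → v ≢ x → Split (codes R M) u v x →
                dist G conn (w u) (w x) ≢ dist G conn (w v) (w x)
  split⇒dist≢ {u} {v} {x} u≢x v≢x s =
    apart⇒≢ (subst₂ Apart (lookup-codes u x) (lookup-codes v x) s) (code-means u≢x) (code-means v≢x)

  ¬resolving : ¬ Resolving R M
  ¬resolving (resolving p q res) = none (w ∘ others p q) resolved
    where
    ≢p : ∀ i → others p q i ≢ p
    ≢p i = punchInᵢ≢i p (punchIn q i)
    ≢q : ∀ i → others p q i ≢ punchIn p q
    ≢q i eq = punchInᵢ≢i q i (punchIn-injective p _ _ eq)
    resolved : ResolvedOutside G conn (w ∘ others p q)
    resolved i j i<j =
      [ (λ s → w p , (λ l → ≢p l ∘ w-inj) , split⇒dist≢ (≢p i) (≢p j) s)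
      , (λ s → w (punchIn p q) , (λ l → ≢q l ∘ w-inj) , split⇒dist≢ (≢q i) (≢q j) s)
      ]′ (res i j i<j)

rows : Type → Type → Bool → Vec (Vec Bool 6) 6
rows (x₀ ∷ x₁ ∷ x₂ ∷ x₃ ∷ []) (y₀ ∷ y₁ ∷ y₂ ∷ y₃ ∷ []) e =
  (false ∷ true  ∷ false ∷ false ∷ x₀    ∷ y₀    ∷ []) ∷
  (true  ∷ false ∷ true  ∷ false ∷ x₁    ∷ y₁    ∷ []) ∷
  (false ∷ true  ∷ false ∷ true  ∷ x₂    ∷ y₂    ∷ []) ∷
  (false ∷ false ∷ true  ∷ false ∷ x₃    ∷ y₃    ∷ []) ∷
  (x₀    ∷ x₁    ∷ x₂    ∷ x₃    ∷ false ∷ e     ∷ []) ∷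
  (y₀    ∷ y₁    ∷ y₂    ∷ y₃    ∷ e     ∷ false ∷ []) ∷ []

matrix : Type → Type → Bool → Matrix
matrix x y e i j = lookup (lookup (rows x y e) i) j

oppositeMatrix : Matrix → Matrix
oppositeMatrix M i j = not (does (i ≟ j)) ∧ not (M i j)

-- One graph of the pair suffices, since in an extremal pair neither contains four vertices resolved
-- from outside.
record Excluded (R : Rule) (x y : Type) (e : Bool) : Set where
  constructor excluded
  field
    either : Resolving R (matrix x y e) ⊎ Resolving R (oppositeMatrix (matrix x y e))

excluded? : ∀ R x y e → Dec (Excluded R x y e)
excluded? R x y e = map′ excluded Excluded.either $
  resolving? R (matrix x y e) ⊎-dec resolving? R (oppositeMatrix (matrix x y e))

allBool? : ∀ {P : Bool → Set} → (∀ b → Dec (P b)) → Dec (∀ b → P b)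
allBool? P? = map′ (λ { (f , t) false → f ; (f , t) true → t }) (λ h → h false , h true)
                   (P? false ×-dec P? true)

allType? : ∀ {P : Type → Set} → (∀ t → Dec (P t)) → Dec (∀ t → P t)
allType? P? = map′ (λ { h (a ∷ b ∷ c ∷ d ∷ []) → h a b c d }) (λ h a b c d → h _)
  (allBool? λ a → allBool? λ b → allBool? λ c → allBool? λ d → P? (a ∷ b ∷ c ∷ d ∷ []))

-- Abstract, so that these computations are not repeated on symbolic types.
abstract
  excluded-pentagon : ∀ y e → Excluded never (true ∷ false ∷ false ∷ true ∷ []) y e
  excluded-pentagon = from-yes (allType? λ y → allBool? λ e →
    excluded? never (true ∷ false ∷ false ∷ true ∷ []) y e)

  -- The first vertex is an arbitrary common neighbour of a and d, the second a certifying one. As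
  -- the test runs under `never`, the soundness of `local` rests on no earlier claim of its kind.
  excluded-shortcut : ∀ y₂ y₃ z e → T (certifies z) →
                      Excluded never (true ∷ y₂ ∷ y₃ ∷ true ∷ []) z e
  excluded-shortcut = from-yes (allBool? λ y₂ → allBool? λ y₃ → allType? λ z → allBool? λ e →
    T? (certifies z) →-dec excluded? never (true ∷ y₂ ∷ y₃ ∷ true ∷ []) z e)

  -- A vertex attached to the path at a alone has no further neighbour y.
  excluded-pendant : ∀ y → Excluded never (true ∷ false ∷ false ∷ false ∷ []) y true
  excluded-pendant = from-yes (allType? λ y →
    excluded? never (true ∷ false ∷ false ∷ false ∷ []) y true)

  excluded-isolated : ∀ y → Excluded local (false ∷ false ∷ false ∷ false ∷ []) y true
  excluded-isolated = from-yes (allType? λ y →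
    excluded? local (false ∷ false ∷ false ∷ false ∷ []) y true)

-- A leaf is a false twin of a or c; the prefix co passes to the complement, with its path
-- b - d - a - c, and ʳ reverses the path.  In an extremal graph, bad leaves only the pentagon.
Kind : Set
Kind = Fin 6

pattern leaf    = 0F
pattern coleaf  = 1F
pattern leafʳ   = 2F
pattern coleafʳ = 3F
pattern bull    = 4F
pattern bad     = 5F

kind : Type → Kind
kind (false ∷ true  ∷ false ∷ _     ∷ []) = leaf
kind (true  ∷ true  ∷ _     ∷ false ∷ []) = coleaf
kind (_     ∷ false ∷ true  ∷ false ∷ []) = leafʳ
kind (false ∷ _     ∷ true  ∷ true  ∷ []) = coleafʳ
kind (false ∷ true  ∷ true  ∷ false ∷ []) = bull
kind _                                    = bad

edge : Kind → Bool
edge coleaf  = true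
edge coleafʳ = true
edge _       = false

-- Pairs with a `bad` member pass here because `kind≢bad` treats those vertices singly. Two vertices
-- of kind `bull` never coexist, which confines the bull to order 5.
Allowed : Kind → Kind → Bool → Set
Allowed k l e = k ≡ bad ⊎ l ≡ bad ⊎ (k ≡ l × k ≢ bull × e ≡ edge k)

allowed? : ∀ k l e → Dec (Allowed k l e)
allowed? k l e = (k ≟ bad) ⊎-dec (l ≟ bad) ⊎-dec (k ≟ l ×-dec ¬? (k ≟ bull) ×-dec (e Bool.≟ edge k))

abstract
  allowed-or-excluded : ∀ x y e → Allowed (kind x) (kind y) e ⊎ Excluded always x y e
  allowed-or-excluded = from-yes (allType? λ x → allType? λ y → allBool? λ e →
    allowed? (kind x) (kind y) e ⊎-dec excluded? always x y e)

adjᵇ : ∀ {V} → Graph V → V → V → Bool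
adjᵇ G u v = does (adj? G u v)

adjᵇ-sym : ∀ {V} (G : Graph V) u v → adjᵇ G u v ≡ adjᵇ G v u
adjᵇ-sym G u v = does-⇔ (mk⇔ (symm G) (symm G)) (adj? G u v) (adj? G v u)

type : ∀ {V} → Graph V → (a b c d x : V) → Type
type G a b c d x = adjᵇ G x a ∷ adjᵇ G x b ∷ adjᵇ G x c ∷ adjᵇ G x d ∷ []

record Outside {V : Set} (a b c d x : V) : Set where
  constructor off
  field
    ≢a : x ≢ a
    ≢b : x ≢ b
    ≢c : x ≢ c
    ≢d : x ≢ d

module _ {n} (G : Graph (Fin n)) {a b c d} (p : InducedP₄ G a b c d) {x y}
         (x∉ : Outside a b c d x) (y∉ : Outside a b c d y) (x≢y : x ≢ y) where
  open InducedP₄ p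
  private
    module X = Outside x∉
    module Y = Outside y∉

  six : Fin 6 → Fin n
  six = lookup (a ∷ b ∷ c ∷ d ∷ x ∷ y ∷ [])

  six-injective : Injective _≡_ _≡_ six
  six-injective = lookup-injective
    ( (a≢b p ∷ a≢c p ∷ a≢d p ∷ ≢-sym X.≢a ∷ ≢-sym Y.≢a ∷ [])
    ∷ (b≢c p ∷ b≢d p ∷ ≢-sym X.≢b ∷ ≢-sym Y.≢b ∷ [])
    ∷ (c≢d p ∷ ≢-sym X.≢c ∷ ≢-sym Y.≢c ∷ [])
    ∷ (≢-sym X.≢d ∷ ≢-sym Y.≢d ∷ [])
    ∷ (x≢y ∷ []) ∷ [] ∷ []) _ _

  agrees : Agrees (matrix (type G a b c d x) (type G a b c d y) (adjᵇ G x y)) G six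
  agrees 0F 0F = sym (dec-false (adj? G a a) (irrefl G refl))
  agrees 0F 1F = sym (dec-true (adj? G a b) ab)
  agrees 0F 2F = sym (dec-false (adj? G a c) ¬ac)
  agrees 0F 3F = sym (dec-false (adj? G a d) ¬ad)
  agrees 0F 4F = adjᵇ-sym G x a
  agrees 0F 5F = adjᵇ-sym G y a
  agrees 1F 0F = sym (dec-true (adj? G b a) (symm G ab))
  agrees 1F 1F = sym (dec-false (adj? G b b) (irrefl G refl))
  agrees 1F 2F = sym (dec-true (adj? G b c) bc)
  agrees 1F 3F = sym (dec-false (adj? G b d) ¬bd)
  agrees 1F 4F = adjᵇ-sym G x b
  agrees 1F 5F = adjᵇ-sym G y b
  agrees 2F 0F = sym (dec-false (adj? G c a) (¬ac ∘ symm G))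
  agrees 2F 1F = sym (dec-true (adj? G c b) (symm G bc))
  agrees 2F 2F = sym (dec-false (adj? G c c) (irrefl G refl))
  agrees 2F 3F = sym (dec-true (adj? G c d) cd)
  agrees 2F 4F = adjᵇ-sym G x c
  agrees 2F 5F = adjᵇ-sym G y c
  agrees 3F 0F = sym (dec-false (adj? G d a) (¬ad ∘ symm G))
  agrees 3F 1F = sym (dec-false (adj? G d b) (¬bd ∘ symm G))
  agrees 3F 2F = sym (dec-true (adj? G d c) (symm G cd))
  agrees 3F 3F = sym (dec-false (adj? G d d) (irrefl G refl))
  agrees 3F 4F = adjᵇ-sym G x d
  agrees 3F 5F = adjᵇ-sym G y d
  agrees 4F 0F = refl
  agrees 4F 1F = refl
  agrees 4F 2F = refl
  agrees 4F 3F = refl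
  agrees 4F 4F = sym (dec-false (adj? G x x) (irrefl G refl))
  agrees 4F 5F = refl
  agrees 5F 0F = refl
  agrees 5F 1F = refl
  agrees 5F 2F = refl
  agrees 5F 3F = refl
  agrees 5F 4F = adjᵇ-sym G x y
  agrees 5F 5F = sym (dec-false (adj? G y y) (irrefl G refl))

agrees-opposite : ∀ {n} {A B : Graph (Fin n)} → Opposite A B →
                  ∀ M {w : Fin 6 → Fin n} → Injective _≡_ _≡_ w → Agrees M A w →
                  Agrees (oppositeMatrix M) B w
agrees-opposite {A = A} {B} opp M {w} w-inj agree i j with i ≟ j | M i j | agree i j
... | yes refl | _ | _ = sym (dec-false (adj? B (w i) (w i)) (irrefl B refl))
... | no i≢j | m | eq with adj? A (w i) (w j)
...   | yes ij rewrite eq = sym (dec-false (adj? B (w i) (w j)) (λ ij′ → Opposite.from opp ij′ ij))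
...   | no ¬ij rewrite eq = sym (dec-true (adj? B (w i) (w j)) (Opposite.to opp (i≢j ∘ w-inj) ¬ij))

-- Extremal pairs

-- `none-A` and `none-B` express that both location numbers are at least n - 3.
record Extremal {n} (A B : Graph (Fin n)) : Set where
  field
    conn-A   : Connected A
    conn-B   : Connected B
    opposite : Opposite A B
    none-A   : NoneResolved A conn-A 4
    none-B   : NoneResolved B conn-B 4

swap-extremal : ∀ {n} {A B : Graph (Fin n)} → Extremal A B → Extremal B A
swap-extremal e = record
  { conn-A = conn-B ; conn-B = conn-A ; opposite = opposite-sym opposite
  ; none-A = none-B ; none-B = none-A }
  where open Extremal e

type-≡ : ∀ {p q r s p′ q′ r′ s′ : Bool} → p ≡ p′ → q ≡ q′ → r ≡ r′ → s ≡ s′ →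
         _≡_ {A = Type} (p ∷ q ∷ r ∷ s ∷ []) (p′ ∷ q′ ∷ r′ ∷ s′ ∷ [])
type-≡ refl refl refl refl = refl

adj⇒adjᵇ : ∀ {V} (G : Graph V) {u v} → Adj G u v → adjᵇ G u v ≡ true
adj⇒adjᵇ G = dec-true (adj? G _ _)

¬adj⇒adjᵇ : ∀ {V} (G : Graph V) {u v} → ¬ Adj G u v → adjᵇ G u v ≡ false
¬adj⇒adjᵇ G = dec-false (adj? G _ _)

adjᵇ⇒adj : ∀ {V} (G : Graph V) {u v} → adjᵇ G u v ≡ true → Adj G u v
adjᵇ⇒adj G {u} {v} eq = decidable-stable (adj? G u v) λ ¬a →
  contradiction (trans (sym eq) (¬adj⇒adjᵇ G ¬a)) λ ()

adjᵇ⇒¬adj : ∀ {V} (G : Graph V) {u v} → adjᵇ G u v ≡ false → ¬ Adj G u v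
adjᵇ⇒¬adj G eq a = contradiction (trans (sym eq) (adj⇒adjᵇ G a)) λ ()

separated : ∀ {V} (G : Graph V) {x y z} → Adj G x y → ¬ Adj G x z → y ≢ z
separated G xy ¬xz refl = ¬xz xy

never-sound : ∀ {n} (G : Graph (Fin n)) → RuleSound never G
never-sound G _ _ _ _ ()

¬excluded : ∀ {n} {A B : Graph (Fin n)} → Extremal A B → ∀ R → RuleSound R A → RuleSound R B →
            ∀ {a b c d} → InducedP₄ A a b c d →
            ∀ {x y} → Outside a b c d x → Outside a b c d y → x ≢ y →
            ¬ Excluded R (type A a b c d x) (type A a b c d y) (adjᵇ A x y)
¬excluded {A = A} {B} ext R sound-A sound-B {a} {b} {c} {d} p {x} {y} x∉ y∉ x≢y =
  [ ¬resolving A conn-A none-A {R} sound-A w w-inj m w-agrees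
  , ¬resolving B conn-B none-B {R} sound-B w w-inj (oppositeMatrix m)
               (agrees-opposite opposite m w-inj w-agrees) ]′
  ∘ Excluded.either
  where
  open Extremal ext
  w = six A p x∉ y∉ x≢y
  w-inj = six-injective A p x∉ y∉ x≢y
  m = matrix (type A a b c d x) (type A a b c d y) (adjᵇ A x y)
  w-agrees : Agrees m A w
  w-agrees = agrees A p x∉ y∉ x≢y

¬certifies-ends : ∀ q r → ¬ T (certifies (true ∷ q ∷ r ∷ true ∷ []))
¬certifies-ends true  _     ()
¬certifies-ends false true  ()
¬certifies-ends false false ()

module _ {n} {A B : Graph (Fin n)} (ext : Extremal A B) where
  open Extremal ext

  -- `y` and `z` would form an excluded pair. They are distinct because a common neighbour of a and
  -- d never has a certifying type.
  no-shortcut : ∀ {a b c d} → InducedP₄ A a b c d → ∀ {z} → Outside a b c d z →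
                T (certifies (type A a b c d z)) → ∀ {y} → Adj A y a → Adj A y d → ⊥
  no-shortcut {a} {b} {c} {d} p {z} z∉ cert {y} ya yd =
    ¬excluded ext never (never-sound A) (never-sound B) p y∉ z∉ y≢z
      (subst (λ t → Excluded never t (type A a b c d z) (adjᵇ A y z)) (sym type-y)
        (excluded-shortcut (adjᵇ A y b) (adjᵇ A y c) (type A a b c d z) (adjᵇ A y z) cert))
    where
    open InducedP₄ p
    y∉ : Outside a b c d y
    y∉ = off (adj⇒≢ A ya) (λ { refl → ¬bd yd }) (λ { refl → ¬ac (symm A ya) }) (adj⇒≢ A yd)
    type-y : type A a b c d y ≡ true ∷ adjᵇ A y b ∷ adjᵇ A y c ∷ true ∷ []
    type-y = type-≡ (adj⇒adjᵇ A ya) refl refl (adj⇒adjᵇ A yd)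
    y≢z : y ≢ z
    y≢z refl = ¬certifies-ends (adjᵇ A y b) (adjᵇ A y c) (subst (T ∘ certifies) type-y cert)

  local-sound : RuleSound local A
  local-sound w {M} w-inj agree {i} {j} {k} {l} p (z , (z≢i , z≢j , z≢k , z≢l) , cert) iy ly =
    no-shortcut p (off (z≢i ∘ w-inj) (z≢j ∘ w-inj) (z≢k ∘ w-inj) (z≢l ∘ w-inj))
      (subst (T ∘ certifies) (type-≡ (agree z i) (agree z j) (agree z k) (agree z l)) cert)
      (symm A iy) (symm A ly)

  pentagon-all : ∀ {a b c d} → InducedP₄ A a b c d → ∀ {x} → Outside a b c d x →
                 Adj A x a → ¬ Adj A x b → ¬ Adj A x c → Adj A x d →
                 ∀ {y} → Outside a b c d y → x ≢ y → ⊥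
  pentagon-all {a} {b} {c} {d} p {x} x∉ xa ¬xb ¬xc xd {y} y∉ x≢y =
    ¬excluded ext never (never-sound A) (never-sound B) p x∉ y∉ x≢y
      (subst (λ t → Excluded never t (type A a b c d y) (adjᵇ A x y))
        (sym (type-≡ (adj⇒adjᵇ A xa) (¬adj⇒adjᵇ A ¬xb) (¬adj⇒adjᵇ A ¬xc) (adj⇒adjᵇ A xd)))
        (excluded-pentagon (type A a b c d y) (adjᵇ A x y)))

  -- N(x) = {a} and a, d have no common neighbour, so x is at distances 1, 2, 3 and at least 4
  -- from a, b, c and d.
  no-inducedP₅ : ∀ {a b c d} → InducedP₄ A a b c d → ∀ {x} → Outside a b c d x →
                 Adj A x a → ¬ Adj A x b → ¬ Adj A x c → ¬ Adj A x d → ⊥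
  no-inducedP₅ {a} {b} {c} {d} p {x} x∉ xa ¬xb ¬xc ¬xd = none-A _ resolved
    where
    open InducedP₄ p
    open Outside x∉
    type-x : type A a b c d x ≡ true ∷ false ∷ false ∷ false ∷ []
    type-x = type-≡ (adj⇒adjᵇ A xa) (¬adj⇒adjᵇ A ¬xb) (¬adj⇒adjᵇ A ¬xc) (¬adj⇒adjᵇ A ¬xd)
    only-a : ∀ {y} → Adj A x y → y ≡ a
    only-a {y} xy = decidable-stable (y ≟ a) λ y≢a →
      ¬excluded ext never (never-sound A) (never-sound B) p x∉
        (off y≢a (separated A xy ¬xb) (separated A xy ¬xc) (separated A xy ¬xd)) (adj⇒≢ A xy)
        (subst₂ (λ t e → Excluded never t (type A a b c d y) e) (sym type-x) (sym (adj⇒adjᵇ A xy))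
          (excluded-pendant (type A a b c d y)))
    certified : T (certifies (type A a b c d x))
    certified = subst (T ∘ certifies) (sym type-x) tt
    no-3-walk : ∀ {k} → Walk A d k x → 4 ≤ k
    no-3-walk []                     = contradiction refl ≢d
    no-3-walk (dx ∷ [])              = contradiction (symm A dx) ¬xd
    no-3-walk (dq ∷ (qx ∷ []))       =
      contradiction (symm A (subst (Adj A d) (only-a (symm A qx)) dq)) ¬ad
    no-3-walk (dq ∷ (qp ∷ (px ∷ []))) =
      ⊥-elim (no-shortcut p x∉ certified (subst (Adj A _) (only-a (symm A px)) qp) (symm A dq))
    no-3-walk (_ ∷ (_ ∷ (_ ∷ (_ ∷ _)))) = s≤s (s≤s (s≤s (s≤s z≤n)))
    xa-1 : dist A conn-A a x ≡ 1
    xa-1 = adj⇒dist≡1 A conn-A (symm A xa)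
    xb-2 : dist A conn-A b x ≡ 2
    xb-2 = common⇒dist≡2 A conn-A (≢-sym ≢b) (¬xb ∘ symm A) (symm A ab) xa
    xc-3 : dist A conn-A c x ≡ 3
    xc-3 = ℕ.≤-antisym (dist-min A conn-A (symm A bc ∷ (symm A ab ∷ (symm A xa ∷ []))))
      (dist≥3 A conn-A (≢-sym ≢c) (¬xc ∘ symm A)
        λ z cz xz → ¬ac (symm A (subst (Adj A c) (only-a xz) cz)))
    resolved : ResolvedOutside A conn-A (lookup (a ∷ b ∷ c ∷ d ∷ []))
    resolved = resolve-increasing A conn-A {x = x} (≢-sym ≢a) (≢-sym ≢b) (≢-sym ≢c) (≢-sym ≢d)
      (subst₂ _<_ (sym xa-1) (sym xb-2) ℕ.≤-refl)
      (subst₂ _<_ (sym xb-2) (sym xc-3) ℕ.≤-refl)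
      (subst (_< _) (sym xc-3) (no-3-walk (dist-walk A conn-A d x)))

-- By connectedness `x` has a neighbour, which lies off the path as well, and this pair is excluded
-- whatever the type of the neighbour.
no-isolated : ∀ {n} {A B : Graph (Fin n)} → Extremal A B →
              ∀ {a b c d} → InducedP₄ A a b c d → ∀ {x} → Outside a b c d x →
              ¬ Adj A x a → ¬ Adj A x b → ¬ Adj A x c → ¬ Adj A x d → ⊥
no-isolated {A = A} ext {a} {b} {c} {d} p {x} x∉ ¬xa ¬xb ¬xc ¬xd =
  let y , xy = neighbour {G = A} (Extremal.conn-A ext) (Outside.≢a x∉) in
  ¬excluded ext local (local-sound ext) (local-sound (swap-extremal ext)) p x∉
    (off (separated A xy ¬xa) (separated A xy ¬xb) (separated A xy ¬xc) (separated A xy ¬xd))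
    (adj⇒≢ A xy)
    (subst₂ (λ t e → Excluded local t (type A a b c d y) e)
      (sym (type-≡ (¬adj⇒adjᵇ A ¬xa) (¬adj⇒adjᵇ A ¬xb) (¬adj⇒adjᵇ A ¬xc) (¬adj⇒adjᵇ A ¬xd)))
      (sym (adj⇒adjᵇ A xy))
      (excluded-isolated (type A a b c d y)))

five : ∀ {V : Set} (a b c d x : V) → Fin 5 → V
five a b c d x = lookup (a ∷ b ∷ c ∷ d ∷ x ∷ [])

unlisted⇒outside : ∀ {n} {a b c d v : Fin n} →
                   (∀ i → lookup (a ∷ b ∷ c ∷ d ∷ []) i ≢ v) → Outside a b c d v
unlisted⇒outside ≢v = off (≢-sym (≢v 0F)) (≢-sym (≢v 1F)) (≢-sym (≢v 2F)) (≢-sym (≢v 3F))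

five-surjective : ∀ {n} {a b c d x : Fin n} → (∀ {y} → Outside a b c d y → x ≢ y → ⊥) →
                  ∀ v → ∃ λ i → five a b c d x i ≡ v
five-surjective {a = a} {b} {c} {d} {x} all v =
  decidable-stable (any? λ i → five a b c d x i ≟ v) λ ¬i →
    all (unlisted⇒outside λ { 0F eq → ¬i (0F , eq) ; 1F eq → ¬i (1F , eq)
                            ; 2F eq → ¬i (2F , eq) ; 3F eq → ¬i (3F , eq) })
        (λ eq → ¬i (4F , eq))

surjective⇒≤ : ∀ {m n} {f : Fin m → Fin n} → (∀ v → ∃ λ i → f i ≡ v) → n ≤ m
surjective⇒≤ {f = f} sur = injective⇒≤ {f = proj₁ ∘ sur} λ {u} {v} eq →
  trans (sym (proj₂ (sur u))) (trans (cong f eq) (proj₂ (sur v)))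

outside-reverse : ∀ {V : Set} {a b c d x : V} → Outside a b c d x → Outside d c b a x
outside-reverse (off ≢a ≢b ≢c ≢d) = off ≢d ≢c ≢b ≢a

module _ {n} {A B : Graph (Fin n)} (ext : Extremal A B)
         {a b c d : Fin n} (p : InducedP₄ A a b c d) {x : Fin n} (x∉ : Outside a b c d x) where
  open Extremal ext
  open Opposite opposite
  open Outside x∉

  -- In `B`, `x` has no neighbour on the path b - d - a - c.
  no-dominating : Adj A x a → Adj A x b → Adj A x c → Adj A x d → ⊥
  no-dominating xa xb xc xd =
    no-isolated (swap-extremal ext) (opposite-P₄ opposite p) (off ≢b ≢d ≢a ≢c)
      (λ o → from o xb) (λ o → from o xd) (λ o → from o xa) (λ o → from o xc)

  -- The house is the complement of P₅: in `B`, x - c - a - d - b is an induced path.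
  no-house : Adj A x a → Adj A x b → ¬ Adj A x c → Adj A x d → ⊥
  no-house xa xb ¬xc xd =
    no-inducedP₅ (swap-extremal ext) (reverse (opposite-P₄ opposite p)) (off ≢c ≢a ≢d ≢b)
      (to ≢c ¬xc) (λ o → from o xa) (λ o → from o xd) (λ o → from o xb)

-- According to its adjacency to b and c, a common neighbour of a and d closes a pentagon, forms a
-- house in one of two positions, or dominates the path. Only the pentagon can occur in an extremal
-- pair, and it leaves no room for a sixth vertex.
ends-remote : ∀ {n} {A B : Graph (Fin n)} → Extremal A B → 6 ≤ n →
              ∀ {a b c d} → InducedP₄ A a b c d → ∀ {y} → Adj A y a → Adj A y d → ⊥
ends-remote {A = A} ext n≥6 {a} {b} {c} {d} p {y} ya yd = go (adj? A y b) (adj? A y c)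
  where
  open InducedP₄ p
  y∉ : Outside a b c d y
  y∉ = off (adj⇒≢ A ya) (λ { refl → ¬bd yd }) (λ { refl → ¬ac (symm A ya) }) (adj⇒≢ A yd)
  go : Dec (Adj A y b) → Dec (Adj A y c) → ⊥
  go (no ¬yb) (no ¬yc) = ℕ.<⇒≱ n≥6
    (surjective⇒≤ (five-surjective (pentagon-all ext p y∉ ya ¬yb ¬yc yd)))
  go (yes yb) (yes yc) = no-dominating ext p y∉ ya yb yc yd
  go (yes yb) (no ¬yc) = no-house ext p y∉ ya yb ¬yc yd
  go (no ¬yb) (yes yc) = no-house ext (reverse p) (outside-reverse y∉) yd yc ¬yb ya

always-sound : ∀ {n} {A B : Graph (Fin n)} → Extremal A B → 6 ≤ n → RuleSound always A
always-sound {A = A} ext n≥6 w w-inj agree p _ iz lz = ends-remote ext n≥6 p (symm A iz) (symm A lz)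

allowed : ∀ {n} {A B : Graph (Fin n)} → Extremal A B →
          ∀ {a b c d} → InducedP₄ A a b c d →
          ∀ {x y} → Outside a b c d x → Outside a b c d y → x ≢ y →
          Allowed (kind (type A a b c d x)) (kind (type A a b c d y)) (adjᵇ A x y)
allowed {A = A} ext {a} {b} {c} {d} p {x} {y} x∉ y∉ x≢y =
  [ id
  , ⊥-elim ∘ ¬excluded ext always (always-sound ext n≥6) (always-sound (swap-extremal ext) n≥6)
                       p x∉ y∉ x≢y ]′
    (allowed-or-excluded (type A a b c d x) (type A a b c d y) (adjᵇ A x y))
  where
  n≥6 = injective⇒≤ (six-injective A p x∉ y∉ x≢y)

Pentagon : ∀ {V} → Graph V → (a b c d x : V) → Set
Pentagon G a b c d x = Adj G x a × ¬ Adj G x b × ¬ Adj G x c × Adj G x d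

-- Seven types are bad: no neighbour on the path, one end only (twice), both ends only, both ends
-- and one inner vertex (twice), and all four. Each has its own exclusion.
kind≢bad : ∀ {n} {A B : Graph (Fin n)} → Extremal A B →
           ∀ {a b c d} → InducedP₄ A a b c d → ∀ {x} → Outside a b c d x → ¬ Pentagon A a b c d x →
           kind (type A a b c d x) ≢ bad
kind≢bad {A = A} ext {a} {b} {c} {d} p {x} x∉ ¬pent =
  go (adj? A x a) (adj? A x b) (adj? A x c) (adj? A x d)
  where
  go : (xa? : Dec (Adj A x a)) (xb? : Dec (Adj A x b))
       (xc? : Dec (Adj A x c)) (xd? : Dec (Adj A x d)) →
       kind (does xa? ∷ does xb? ∷ does xc? ∷ does xd? ∷ []) ≢ bad
  go (no ¬xa) (no ¬xb) (no ¬xc) (no ¬xd) _ = no-isolated ext p x∉ ¬xa ¬xb ¬xc ¬xd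
  go (yes xa) (no ¬xb) (no ¬xc) (no ¬xd) _ = no-inducedP₅ ext p x∉ xa ¬xb ¬xc ¬xd
  go (no ¬xa) (no ¬xb) (no ¬xc) (yes xd) _ =
    no-inducedP₅ ext (reverse p) (outside-reverse x∉) xd ¬xc ¬xb ¬xa
  go (yes xa) (no ¬xb) (no ¬xc) (yes xd) _ = ¬pent (xa , ¬xb , ¬xc , xd)
  go (yes xa) (yes xb) (no ¬xc) (yes xd) _ = no-house ext p x∉ xa xb ¬xc xd
  go (yes xa) (no ¬xb) (yes xc) (yes xd) _ =
    no-house ext (reverse p) (outside-reverse x∉) xd xc ¬xb xa
  go (yes xa) (yes xb) (yes xc) (yes xd) _ = no-dominating ext p x∉ xa xb xc xd
  go (no _)  (yes _) (no _)  (no _)  ()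
  go (no _)  (yes _) (no _)  (yes _) ()
  go (yes _) (yes _) (no _)  (no _)  ()
  go (yes _) (yes _) (yes _) (no _)  ()
  go (no _)  (no _)  (yes _) (no _)  ()
  go (yes _) (no _)  (yes _) (no _)  ()
  go (no _)  (no _)  (yes _) (yes _) ()
  go (no _)  (yes _) (yes _) (yes _) ()
  go (no _)  (yes _) (yes _) (no _)  ()

-- The structure of extremal pairs

placement⇒≅ : ∀ {n} {V : Set} {G : Graph (Fin n)} {H : Graph V} (w : V → Fin n) →
              Injective _≡_ _≡_ w → (∀ v → ∃ λ i → w i ≡ v) →
              (∀ i j → Adj H i j ⇔ Adj G (w i) (w j)) → G ≅ H
placement⇒≅ {G = G} {H} w w-inj sur iff = record
  { bijection = mk↔ₛ′ (proj₁ ∘ sur) w (λ i → w-inj (proj₂ (sur (w i)))) (proj₂ ∘ sur)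
  ; adj-iff = λ u v → mk⇔
      (λ uv → Equivalence.from (iff _ _)
        (subst₂ (Adj G) (sym (proj₂ (sur u))) (sym (proj₂ (sur v))) uv))
      (λ ij → subst₂ (Adj G) (proj₂ (sur u)) (proj₂ (sur v)) (Equivalence.to (iff _ _) ij))
  }

allPairs-lookup : ∀ {A : Set} {R : A → A → Set} {n} {xs : Vec A n} → AllPairs R xs →
                  ∀ i j → i F.< j → R (lookup xs i) (lookup xs j)
allPairs-lookup (px ∷ _)  zero    (suc j) _         = All.lookup⁺ px j
allPairs-lookup (_ ∷ pxs) (suc i) (suc j) (s≤s i<j) = allPairs-lookup pxs i j i<j

pairwise⇒adj⇔ : ∀ {m n} (G : Graph (Fin n)) (H : Graph (Fin m)) (w : Fin m → Fin n) →
                AllPairs (λ i j → adjᵇ G (w i) (w j) ≡ adjᵇ H i j) (allFin m) →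
                ∀ i j → Adj H i j ⇔ Adj G (w i) (w j)
pairwise⇒adj⇔ {m} G H w pairs i j = mk⇔
  (λ ij → adjᵇ⇒adj G (trans (same i j) (adj⇒adjᵇ H ij)))
  (λ wij → adjᵇ⇒adj H (trans (sym (same i j)) (adj⇒adjᵇ G wij)))
  where
  below : ∀ i j → i F.< j → adjᵇ G (w i) (w j) ≡ adjᵇ H i j
  below i j i<j = subst₂ (λ i j → adjᵇ G (w i) (w j) ≡ adjᵇ H i j)
                    (lookup-allFin i) (lookup-allFin j) (allPairs-lookup pairs i j i<j)
  same : ∀ i j → adjᵇ G (w i) (w j) ≡ adjᵇ H i j
  same i j with <-cmp i j
  ... | tri< i<j _ _  = below i j i<j
  ... | tri≈ _ refl _ = trans (¬adj⇒adjᵇ G (irrefl G refl)) (sym (¬adj⇒adjᵇ H (irrefl H refl)))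
  ... | tri> _ _ j<i  = trans (adjᵇ-sym G (w i) (w j)) (trans (below j i j<i) (adjᵇ-sym H j i))

P₄⇒≅P4 : ∀ {n} {G : Graph (Fin n)} {a b c d} → InducedP₄ G a b c d → n ≤ 4 → G ≅ P 4
P₄⇒≅P4 {n} {G} {a} {b} {c} {d} p n≤4 = placement⇒≅ w w-inj sur (pairwise⇒adj⇔ G (P 4) w
  ( (adj⇒adjᵇ G ab ∷ ¬adj⇒adjᵇ G ¬ac ∷ ¬adj⇒adjᵇ G ¬ad ∷ [])
  ∷ (adj⇒adjᵇ G bc ∷ ¬adj⇒adjᵇ G ¬bd ∷ [])
  ∷ (adj⇒adjᵇ G cd ∷ []) ∷ [] ∷ []))
  where
  open InducedP₄ p
  w : Fin 4 → Fin n
  w = lookup (a ∷ b ∷ c ∷ d ∷ [])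
  w-inj : Injective _≡_ _≡_ w
  w-inj = lookup-injective
    ((a≢b p ∷ a≢c p ∷ a≢d p ∷ []) ∷ (b≢c p ∷ b≢d p ∷ []) ∷ (c≢d p ∷ []) ∷ [] ∷ []) _ _
  sur : ∀ v → ∃ λ i → w i ≡ v
  sur v = decidable-stable (any? λ i → w i ≟ v) λ ¬i →
    -- A vertex off the path would make five distinct vertices.
    ℕ.<⇒≱ (s≤s n≤4) (injective⇒≤ {f = lookup (v ∷ a ∷ b ∷ c ∷ d ∷ [])} (lookup-injective
      ( ((λ eq → ¬i (0F , sym eq)) ∷ (λ eq → ¬i (1F , sym eq)) ∷
         (λ eq → ¬i (2F , sym eq)) ∷ (λ eq → ¬i (3F , sym eq)) ∷ [])
      ∷ (a≢b p ∷ a≢c p ∷ a≢d p ∷ []) ∷ (b≢c p ∷ b≢d p ∷ []) ∷ (c≢d p ∷ []) ∷ [] ∷ []) _ _))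

module _ {n} {G : Graph (Fin n)} {a b c d x : Fin n}
         (p : InducedP₄ G a b c d) (x∉ : Outside a b c d x)
         (all : ∀ {y} → Outside a b c d y → x ≢ y → ⊥) where
  open InducedP₄ p
  open Outside x∉
  private
    five-injective : Injective _≡_ _≡_ (five a b c d x)
    five-injective = lookup-injective
      ( (a≢b p ∷ a≢c p ∷ a≢d p ∷ ≢-sym ≢a ∷ []) ∷ (b≢c p ∷ b≢d p ∷ ≢-sym ≢b ∷ [])
      ∷ (c≢d p ∷ ≢-sym ≢c ∷ []) ∷ (≢-sym ≢d ∷ []) ∷ [] ∷ []) _ _

  pentagon⇒≅C5 : Pentagon G a b c d x → G ≅ C 5
  pentagon⇒≅C5 (xa , ¬xb , ¬xc , xd) =
    placement⇒≅ w five-injective (five-surjective all) (pairwise⇒adj⇔ G (C 5) w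
      ( (adj⇒adjᵇ G ab ∷ ¬adj⇒adjᵇ G ¬ac ∷ ¬adj⇒adjᵇ G ¬ad ∷ adj⇒adjᵇ G (symm G xa) ∷ [])
      ∷ (adj⇒adjᵇ G bc ∷ ¬adj⇒adjᵇ G ¬bd ∷ ¬adj⇒adjᵇ G (¬xb ∘ symm G) ∷ [])
      ∷ (adj⇒adjᵇ G cd ∷ ¬adj⇒adjᵇ G (¬xc ∘ symm G) ∷ [])
      ∷ (adj⇒adjᵇ G (symm G xd) ∷ []) ∷ [] ∷ []))
    where
    w = five a b c d x

  bull⇒≅B : ¬ Adj G x a → Adj G x b → Adj G x c → ¬ Adj G x d → G ≅ B
  bull⇒≅B ¬xa xb xc ¬xd =
    placement⇒≅ w w-inj w-sur (pairwise⇒adj⇔ G B w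
      ( (adj⇒adjᵇ G bc ∷ adj⇒adjᵇ G (symm G xb) ∷ adj⇒adjᵇ G (symm G ab) ∷ ¬adj⇒adjᵇ G ¬bd ∷ [])
      ∷ (adj⇒adjᵇ G (symm G xc) ∷ ¬adj⇒adjᵇ G (¬ac ∘ symm G) ∷ adj⇒adjᵇ G cd ∷ [])
      ∷ (¬adj⇒adjᵇ G ¬xa ∷ ¬adj⇒adjᵇ G ¬xd ∷ [])
      ∷ (¬adj⇒adjᵇ G ¬ad ∷ []) ∷ [] ∷ []))
    where
    -- The order of `bullEdges`: triangle b, c, x, then a pendant at b and d pendant at c.
    w : Fin 5 → Fin n
    w = five b c x a d
    w-inj : Injective _≡_ _≡_ w
    w-inj = lookup-injective
      ( (b≢c p ∷ ≢-sym ≢b ∷ ≢-sym (a≢b p) ∷ b≢d p ∷ []) ∷ (≢-sym ≢c ∷ ≢-sym (a≢c p) ∷ c≢d p ∷ [])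
      ∷ (≢a ∷ ≢d ∷ []) ∷ (a≢d p ∷ []) ∷ [] ∷ []) _ _
    w-sur : ∀ v → ∃ λ i → w i ≡ v
    w-sur = five-surjective λ (off y≢b y≢c y≢x y≢a) d≢y →
      all (off y≢a y≢b y≢c (≢-sym d≢y)) (≢-sym y≢x)

-- P₄[K̄_r⁽¹⁾, K̄_s⁽³⁾] with its vertices 2 and 4 named b and d.  The complement is
-- P₄[K_s⁽¹⁾, K_r⁽²⁾], where b and d become the vertices 4 and 3.
record Star {V : Set} (G : Graph V) (b d : V) : Set where
  field
    distinct : b ≢ d
    nonadj   : ¬ Adj G b d
    hub      : ∀ {v} → v ≢ b → v ≢ d → Adj G v b
    indep    : ∀ {u v} → u ≢ b → u ≢ d → v ≢ b → v ≢ d → ¬ Adj G u v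

leaves⇒star : ∀ {n} {G : Graph (Fin n)} {a b c d} → InducedP₄ G a b c d →
              (∀ {y} → Outside a b c d y → ¬ Adj G y a × Adj G y b × ¬ Adj G y c) →
              (∀ {y z} → Outside a b c d y → Outside a b c d z → ¬ Adj G y z) → Star G b d
leaves⇒star {n} {G} {a} {b} {c} {d} p leaf-adj ¬yz = record
  { distinct = b≢d p
  ; nonadj = ¬bd
  ; hub = λ v≢b v≢d → hub′ (part v≢b v≢d)
  ; indep = λ u≢b u≢d v≢b v≢d → indep′ (part u≢b u≢d) (part v≢b v≢d)
  }
  where
  open InducedP₄ p
  data Part (v : Fin n) : Set where
    is-a : v ≡ a → Part v
    is-c : v ≡ c → Part v
    out  : Outside a b c d v → Part v
  part : ∀ {v} → v ≢ b → v ≢ d → Part v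
  part {v} v≢b v≢d with v ≟ a | v ≟ c
  ... | yes v≡a | _       = is-a v≡a
  ... | no _    | yes v≡c = is-c v≡c
  ... | no v≢a  | no v≢c  = out (off v≢a v≢b v≢c v≢d)
  hub′ : ∀ {v} → Part v → Adj G v b
  hub′ (is-a refl) = ab
  hub′ (is-c refl) = symm G bc
  hub′ (out y∉)    = proj₁ (proj₂ (leaf-adj y∉))
  indep′ : ∀ {u v} → Part u → Part v → ¬ Adj G u v
  indep′ (is-a refl) (is-a refl) = irrefl G refl
  indep′ (is-a refl) (is-c refl) = ¬ac
  indep′ (is-a refl) (out y∉)    = proj₁ (leaf-adj y∉) ∘ symm G
  indep′ (is-c refl) (is-a refl) = ¬ac ∘ symm G
  indep′ (is-c refl) (is-c refl) = irrefl G refl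
  indep′ (is-c refl) (out y∉)    = proj₂ (proj₂ (leaf-adj y∉)) ∘ symm G
  indep′ (out y∉)    (is-a refl) = proj₁ (leaf-adj y∉)
  indep′ (out y∉)    (is-c refl) = proj₂ (proj₂ (leaf-adj y∉))
  indep′ (out y∉)    (out z∉)    = ¬yz y∉ z∉

-- The path makes both classes of the star nonempty: a is not adjacent to d, and c is.
Blowup : ∀ {n} → Graph (Fin n) → Set
Blowup G = ∃₂ λ b d → Star G b d × ∃₂ λ a c → InducedP₄ G a b c d

leaf-bits : ∀ t → kind t ≡ leaf → lookup t 0F ≡ false × lookup t 1F ≡ true × lookup t 2F ≡ false
leaf-bits = from-yes (allType? λ t → (kind t ≟ leaf) →-dec
  ((lookup t 0F Bool.≟ false) ×-dec (lookup t 1F Bool.≟ true) ×-dec (lookup t 2F Bool.≟ false)))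

coleaf-bits : ∀ t → kind t ≡ coleaf → lookup t 0F ≡ true × lookup t 1F ≡ true × lookup t 3F ≡ false
coleaf-bits = from-yes (allType? λ t → (kind t ≟ coleaf) →-dec
  ((lookup t 0F Bool.≟ true) ×-dec (lookup t 1F Bool.≟ true) ×-dec (lookup t 3F Bool.≟ false)))

leafʳ-bits : ∀ t → kind t ≡ leafʳ → lookup t 1F ≡ false × lookup t 2F ≡ true × lookup t 3F ≡ false
leafʳ-bits = from-yes (allType? λ t → (kind t ≟ leafʳ) →-dec
  ((lookup t 1F Bool.≟ false) ×-dec (lookup t 2F Bool.≟ true) ×-dec (lookup t 3F Bool.≟ false)))

coleafʳ-bits : ∀ t → kind t ≡ coleafʳ →
               lookup t 0F ≡ false × lookup t 2F ≡ true × lookup t 3F ≡ true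
coleafʳ-bits = from-yes (allType? λ t → (kind t ≟ coleafʳ) →-dec
  ((lookup t 0F Bool.≟ false) ×-dec (lookup t 2F Bool.≟ true) ×-dec (lookup t 3F Bool.≟ true)))

bull-bits : ∀ t → kind t ≡ bull →
            (lookup t 0F ≡ false × lookup t 1F ≡ true) × lookup t 2F ≡ true × lookup t 3F ≡ false
bull-bits = from-yes (allType? λ t → (kind t ≟ bull) →-dec
  (((lookup t 0F Bool.≟ false) ×-dec (lookup t 1F Bool.≟ true))
   ×-dec (lookup t 2F Bool.≟ true) ×-dec (lookup t 3F Bool.≟ false)))

outside? : ∀ {n} (a b c d y : Fin n) → Dec (Outside a b c d y)
outside? a b c d y with y ≟ a | y ≟ b | y ≟ c | y ≟ d
... | yes y≡a | _ | _ | _ = no λ o → Outside.≢a o y≡a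
... | no _ | yes y≡b | _ | _ = no λ o → Outside.≢b o y≡b
... | no _ | no _ | yes y≡c | _ = no λ o → Outside.≢c o y≡c
... | no _ | no _ | no _ | yes y≡d = no λ o → Outside.≢d o y≡d
... | no y≢a | no y≢b | no y≢c | no y≢d = yes (off y≢a y≢b y≢c y≢d)

∃-outside : ∀ {n} → 5 ≤ n → ∀ (a b c d : Fin n) → ∃ (Outside a b c d)
∃-outside n≥5 a b c d = decidable-stable (any? (outside? a b c d)) λ ¬o →
  ℕ.<⇒≱ n≥5 (surjective⇒≤ {f = lookup (a ∷ b ∷ c ∷ d ∷ [])} λ v →
    decidable-stable (any? λ i → lookup (a ∷ b ∷ c ∷ d ∷ []) i ≟ v) λ ¬i →
      ¬o (v , unlisted⇒outside λ i eq → ¬i (i , eq)))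

module _ {n} {A B : Graph (Fin n)} (ext : Extremal A B)
         {a b c d : Fin n} (p : InducedP₄ A a b c d)
         (¬pent : ∀ {y} → Outside a b c d y → ¬ Pentagon A a b c d y)
         {x : Fin n} (x∉ : Outside a b c d x) where
  open Extremal ext
  open Opposite opposite
  private
    κ : Fin n → Kind
    κ = kind ∘ type A a b c d

    allowed′ : ∀ {y z} → Outside a b c d y → Outside a b c d z → y ≢ z →
               κ y ≡ κ z × κ y ≢ bull × adjᵇ A y z ≡ edge (κ y)
    allowed′ y∉ z∉ y≢z with allowed ext p y∉ z∉ y≢z
    ... | inj₁ bad-y        = contradiction bad-y (kind≢bad ext p y∉ (¬pent y∉))
    ... | inj₂ (inj₁ bad-z) = contradiction bad-z (kind≢bad ext p z∉ (¬pent z∉))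
    ... | inj₂ (inj₂ ok)    = ok

    same-kind : ∀ {y} → Outside a b c d y → κ y ≡ κ x
    same-kind {y} y∉ with x ≟ y
    ... | yes refl = refl
    ... | no x≢y   = sym (proj₁ (allowed′ x∉ y∉ x≢y))

    edges : ∀ {k y z} → κ x ≡ k → Outside a b c d y → Outside a b c d z → y ≢ z →
            adjᵇ A y z ≡ edge k
    edges eq y∉ z∉ y≢z =
      trans (proj₂ (proj₂ (allowed′ y∉ z∉ y≢z))) (cong edge (trans (same-kind y∉) eq))

    ¬A-edge : ∀ {k y z} → edge k ≡ false → κ x ≡ k →
              Outside a b c d y → Outside a b c d z → ¬ Adj A y z
    ¬A-edge e≡f eq y∉ z∉ yz =
      adjᵇ⇒¬adj A (trans (edges eq y∉ z∉ (adj⇒≢ A yz)) e≡f) yz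

    ¬B-edge : ∀ {k y z} → edge k ≡ true → κ x ≡ k →
              Outside a b c d y → Outside a b c d z → ¬ Adj B y z
    ¬B-edge e≡t eq y∉ z∉ yz =
      from yz (adjᵇ⇒adj A (trans (edges eq y∉ z∉ (adj⇒≢ B yz)) e≡t))

    p′ = opposite-P₄ opposite p

  -- All outside vertices share the kind of `x`. The other three twin kinds reduce to `leaf` along
  -- the reversed path, the path of the complement, or its reversal.
  no-pentagon⇒ : Blowup A ⊎ Blowup B ⊎ A ≅ Defs.B
  no-pentagon⇒ with κ x in eq
  ... | leaf = inj₁ (b , d , leaves⇒star p
        (λ {y} y∉ → let ya , yb , yc = leaf-bits (type A a b c d y) (trans (same-kind y∉) eq) in
          adjᵇ⇒¬adj A ya , adjᵇ⇒adj A yb , adjᵇ⇒¬adj A yc)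
        (¬A-edge refl eq) , a , c , p)
  ... | leafʳ = inj₁ (c , a , leaves⇒star (reverse p)
        (λ {y} (off ≢d ≢c ≢b ≢a) →
          let yb , yc , yd = leafʳ-bits (type A a b c d y)
                             (trans (same-kind (off ≢a ≢b ≢c ≢d)) eq) in
          adjᵇ⇒¬adj A yd , adjᵇ⇒adj A yc , adjᵇ⇒¬adj A yb)
        (λ (off ≢d ≢c ≢b ≢a) (off ≢d′ ≢c′ ≢b′ ≢a′) →
          ¬A-edge refl eq (off ≢a ≢b ≢c ≢d) (off ≢a′ ≢b′ ≢c′ ≢d′)) , d , b , reverse p)
  ... | coleaf = inj₂ (inj₁ (d , c , leaves⇒star p′
        (λ {y} (off ≢b ≢d ≢a ≢c) →
          let ya , yb , yd = coleaf-bits (type A a b c d y)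
                             (trans (same-kind (off ≢a ≢b ≢c ≢d)) eq) in
          (λ o → from o (adjᵇ⇒adj A yb)) , to ≢d (adjᵇ⇒¬adj A yd) , (λ o → from o (adjᵇ⇒adj A ya)))
        (λ (off ≢b ≢d ≢a ≢c) (off ≢b′ ≢d′ ≢a′ ≢c′) →
          ¬B-edge refl eq (off ≢a ≢b ≢c ≢d) (off ≢a′ ≢b′ ≢c′ ≢d′)) , b , a , p′))
  ... | coleafʳ = inj₂ (inj₁ (a , b , leaves⇒star (reverse p′)
        (λ {y} (off ≢c ≢a ≢d ≢b) →
          let ya , yc , yd = coleafʳ-bits (type A a b c d y)
                             (trans (same-kind (off ≢a ≢b ≢c ≢d)) eq) in
          (λ o → from o (adjᵇ⇒adj A yc)) , to ≢a (adjᵇ⇒¬adj A ya) , (λ o → from o (adjᵇ⇒adj A yd)))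
        (λ (off ≢c ≢a ≢d ≢b) (off ≢c′ ≢a′ ≢d′ ≢b′) →
          ¬B-edge refl eq (off ≢a ≢b ≢c ≢d) (off ≢a′ ≢b′ ≢c′ ≢d′)) , c , d , reverse p′))
  ... | bull = inj₂ (inj₂ (let (xa , xb) , xc , xd = bull-bits (type A a b c d x) eq in
        bull⇒≅B p x∉ (λ y∉ x≢y → proj₁ (proj₂ (allowed′ x∉ y∉ x≢y)) eq)
          (adjᵇ⇒¬adj A xa) (adjᵇ⇒adj A xb) (adjᵇ⇒adj A xc) (adjᵇ⇒¬adj A xd)))
  ... | bad = contradiction eq (kind≢bad ext p x∉ (¬pent x∉))

pentagon? : ∀ {V} (G : Graph V) a b c d x → Dec (Pentagon G a b c d x)
pentagon? G a b c d x = adj? G x a ×-dec ¬? (adj? G x b) ×-dec ¬? (adj? G x c) ×-dec adj? G x d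

extremal⇒structure : ∀ {n} {A B : Graph (Fin n)} → 5 ≤ n → Extremal A B →
                     (A ≅ C 5 ⊎ A ≅ Defs.B) ⊎ Blowup A ⊎ Blowup B
extremal⇒structure {n} {A} {B} n≥5 ext =
  decide (any? λ y → outside? a b c d y ×-dec pentagon? A a b c d y)
  where
  open Extremal ext
  path = ∃-inducedP₄ (ℕ.≤-trans (s≤s (s≤s z≤n)) n≥5) conn-A conn-B opposite
  a = proj₁ path
  b = proj₁ (proj₂ path)
  c = proj₁ (proj₂ (proj₂ path))
  d = proj₁ (proj₂ (proj₂ (proj₂ path)))
  p : InducedP₄ A a b c d
  p = proj₂ (proj₂ (proj₂ (proj₂ path)))
  decide : Dec (∃ λ y → Outside a b c d y × Pentagon A a b c d y) →
           (A ≅ C 5 ⊎ A ≅ Defs.B) ⊎ Blowup A ⊎ Blowup B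
  decide (yes (y , y∉ , pent@(ya , ¬yb , ¬yc , yd))) =
    inj₁ (inj₁ (pentagon⇒≅C5 p y∉ (pentagon-all ext p y∉ ya ¬yb ¬yc yd) pent))
  decide (no ¬pent) with no-pentagon⇒ ext p (λ y∉ pent → ¬pent (_ , y∉ , pent))
                                      (proj₂ (∃-outside n≥5 a b c d))
  ... | inj₁ blowup-A        = inj₂ (inj₁ blowup-A)
  ... | inj₂ (inj₁ blowup-B) = inj₂ (inj₂ blowup-B)
  ... | inj₂ (inj₂ A≅B)      = inj₁ (inj₂ A≅B)

-- Lower bounds for the location number

module _ {n} (G : Graph (Fin n)) (conn : Connected G) {b d : Fin n} (R : Fin n → Bool)
         (same : ∀ {u v x} → u ≢ b → u ≢ d → v ≢ b → v ≢ d → R u ≡ R v → x ≢ u → x ≢ v →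
                 dist G conn u x ≡ dist G conn v x)
         (far-from : ∀ {u v x} → u ≢ b → u ≢ d → v ≢ b → v ≢ d → x ≢ b → x ≢ d → x ≢ u → x ≢ v →
                     dist G conn u x ≡ dist G conn v x) where

  colour₁ : Fin n → Fin n → Fin 3
  colour₁ s v with v ≟ s | R v
  ... | yes _ | _     = 0F
  ... | no _  | true  = 1F
  ... | no _  | false = 2F

  colour₁-≡ : ∀ s {u v} → u ≢ v → colour₁ s u ≡ colour₁ s v → u ≢ s × v ≢ s × R u ≡ R v
  colour₁-≡ s {u} {v} u≢v eq with u ≟ s | R u | v ≟ s | R v
  ... | yes u≡s | _     | yes v≡s | _     = contradiction (trans u≡s (sym v≡s)) u≢v
  ... | no u≢s  | true  | no v≢s  | true  = u≢s , v≢s , refl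
  ... | no u≢s  | false | no v≢s  | false = u≢s , v≢s , refl
  colour₁-≡ s u≢v () | yes _ | _ | no _ | true
  colour₁-≡ s u≢v () | yes _ | _ | no _ | false
  colour₁-≡ s u≢v () | no _ | true | yes _ | _
  colour₁-≡ s u≢v () | no _ | false | yes _ | _
  colour₁-≡ s u≢v () | no _ | true | no _ | false
  colour₁-≡ s u≢v () | no _ | false | no _ | true

  colour₂ : Fin n → Fin 3
  colour₂ v with v ≟ b | v ≟ d
  ... | yes _ | _     = 0F
  ... | no _  | yes _ = 1F
  ... | no _  | no _  = 2F

  colour₂-≡ : ∀ {u v} → u ≢ v → colour₂ u ≡ colour₂ v → (u ≢ b × u ≢ d) × v ≢ b × v ≢ d
  colour₂-≡ {u} {v} u≢v eq with u ≟ b | u ≟ d | v ≟ b | v ≟ d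
  ... | yes u≡b | _       | yes v≡b | _       = contradiction (trans u≡b (sym v≡b)) u≢v
  ... | no _    | yes u≡d | no _    | yes v≡d = contradiction (trans u≡d (sym v≡d)) u≢v
  ... | no u≢b  | no u≢d  | no v≢b  | no v≢d  = (u≢b , u≢d) , v≢b , v≢d
  colour₂-≡ u≢v () | yes _ | _ | no _ | yes _
  colour₂-≡ u≢v () | yes _ | _ | no _ | no _
  colour₂-≡ u≢v () | no _ | yes _ | yes _ | _
  colour₂-≡ u≢v () | no _ | yes _ | no _ | no _
  colour₂-≡ u≢v () | no _ | no _ | yes _ | _
  colour₂-≡ u≢v () | no _ | no _ | no _ | yes _

  -- Four vertices in three colours: two agree. If `X` misses b, the colours are d and the two
  -- classes of `R`, and vertices of one class are equidistant from all others; likewise if `X`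
  -- misses d. If `X` contains b and d, neither can be a witness, and by `far-from` no other vertex
  -- tells the remaining members apart.
  classes⇒noneResolved : NoneResolved G conn 4
  classes⇒noneResolved X res with any? (λ i → X i ≟ b) | any? (λ i → X i ≟ d)
  ... | no ¬b | _ =
    let i , j , i<j , eq = pigeonhole (s≤s (s≤s (s≤s (s≤s z≤n)))) (colour₁ d ∘ X)
        x , x∉X , d≢ = res i j i<j
        u≢d , v≢d , Ru≡Rv = colour₁-≡ d (d≢ ∘ cong (λ u → dist G conn u x)) eq
    in d≢ (same (λ e → ¬b (i , e)) u≢d (λ e → ¬b (j , e)) v≢d Ru≡Rv (≢-sym (x∉X i)) (≢-sym (x∉X j)))
  ... | yes _ | no ¬d =
    let i , j , i<j , eq = pigeonhole (s≤s (s≤s (s≤s (s≤s z≤n)))) (colour₁ b ∘ X)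
        x , x∉X , d≢ = res i j i<j
        u≢b , v≢b , Ru≡Rv = colour₁-≡ b (d≢ ∘ cong (λ u → dist G conn u x)) eq
    in d≢ (same u≢b (λ e → ¬d (i , e)) v≢b (λ e → ¬d (j , e)) Ru≡Rv (≢-sym (x∉X i)) (≢-sym (x∉X j)))
  ... | yes (k , Xk≡b) | yes (l , Xl≡d) =
    let i , j , i<j , eq = pigeonhole (s≤s (s≤s (s≤s (s≤s z≤n)))) (colour₂ ∘ X)
        x , x∉X , d≢ = res i j i<j
        (u≢b , u≢d) , v≢b , v≢d = colour₂-≡ (d≢ ∘ cong (λ u → dist G conn u x)) eq
    in d≢ (far-from u≢b u≢d v≢b v≢d (λ x≡b → x∉X k (trans Xk≡b (sym x≡b)))
             (λ x≡d → x∉X l (trans Xl≡d (sym x≡d))) (≢-sym (x∉X i)) (≢-sym (x∉X j)))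

-- Complementation reverses inclusions of neighbourhoods, so `u` and `v` trade places.
twins-opposite : ∀ {n} {A B : Graph (Fin n)} (cA : Connected A) (cB : Connected B) → Opposite A B →
                 ∀ {u v} → Twins A cA v u → Twins B cB u v
twins-opposite cA cB opp tw w w≢u w≢v uw =
  Opposite.to opp (≢-sym w≢v) λ vw → Opposite.from opp uw (tw w w≢v w≢u vw)

module _ {n} {A : Graph (Fin n)} (cA : Connected A) {b d : Fin n} (star : Star A b d) where
  open Star star

  star-twins : ∀ {u v} → u ≢ b → u ≢ d → v ≢ b → v ≢ d → adjᵇ A u d ≡ adjᵇ A v d → Twins A cA u v
  star-twins {u} {v} u≢b u≢d v≢b v≢d eq w _ _ uw with w ≟ b | w ≟ d
  ... | yes refl | _        = hub v≢b v≢d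
  ... | no _     | yes refl = adjᵇ⇒adj A (trans (sym eq) (adj⇒adjᵇ A uw))
  ... | no w≢b   | no w≢d   = contradiction uw (indep u≢b u≢d w≢b w≢d)

  -- Vertices other than b and d are twins if they agree at d, and any two distinct ones are at
  -- distance 2 through b.
  star⇒noneResolved : NoneResolved A cA 4
  star⇒noneResolved = classes⇒noneResolved A cA {b} {d} (λ u → adjᵇ A u d)
    (λ u≢b u≢d v≢b v≢d eq x≢u x≢v → twins⇒dist≡ A cA
       (star-twins u≢b u≢d v≢b v≢d eq) (star-twins v≢b v≢d u≢b u≢d (sym eq)) x≢u x≢v)
    (λ {u} {v} {x} u≢b u≢d v≢b v≢d x≢b x≢d x≢u x≢v → trans
       (common⇒dist≡2 A cA {u} {x} {b} (≢-sym x≢u) (indep u≢b u≢d x≢b x≢d)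
                      (hub u≢b u≢d) (hub x≢b x≢d))
       (sym (common⇒dist≡2 A cA {v} {x} {b} (≢-sym x≢v) (indep v≢b v≢d x≢b x≢d)
                           (hub v≢b v≢d) (hub x≢b x≢d))))

  -- The twins persist, and the distance 2 becomes 1, as these vertices form a clique in `B`.
  star⇒noneResolved-opposite : ∀ {B : Graph (Fin n)} (cB : Connected B) → Opposite A B →
                               NoneResolved B cB 4
  star⇒noneResolved-opposite {B} cB opp = classes⇒noneResolved B cB {b} {d} (λ u → adjᵇ A u d)
    (λ u≢b u≢d v≢b v≢d eq x≢u x≢v → twins⇒dist≡ B cB
       (twins-opposite cA cB opp (star-twins v≢b v≢d u≢b u≢d (sym eq)))
       (twins-opposite cA cB opp (star-twins u≢b u≢d v≢b v≢d eq)) x≢u x≢v)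
    (λ {u} {v} {x} u≢b u≢d v≢b v≢d x≢b x≢d x≢u x≢v → trans
       (adj⇒dist≡1 B cB {u} {x} (Opposite.to opp (≢-sym x≢u) (indep u≢b u≢d x≢b x≢d)))
       (sym (adj⇒dist≡1 B cB {v} {x} (Opposite.to opp (≢-sym x≢v) (indep v≢b v≢d x≢b x≢d)))))

-- The pentagon and the bull

TwoApart : ∀ {n} → Graph (Fin n) → Fin n → Fin n → Set
TwoApart G u x = u ≢ x × ¬ Adj G u x × ∃ λ z → Adj G u z × Adj G x z

-- An obstruction to β = 1 stated by adjacency alone, so that it can be decided on a concrete graph
-- and carried along isomorphisms.
Blind : ∀ {n} → Graph (Fin n) → Set
Blind G = ∀ x → ∃₂ λ u v → u ≢ v × ((Adj G u x × Adj G v x) ⊎ (TwoApart G u x × TwoApart G v x))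

blind? : ∀ {n} (G : Graph (Fin n)) → Dec (Blind G)
blind? G = all? λ x → any? λ u → any? λ v → ¬? (u ≟ v) ×-dec
  ((adj? G u x ×-dec adj? G v x) ⊎-dec (two? u x ×-dec two? v x))
  where
  two? : ∀ u x → Dec (TwoApart G u x)
  two? u x = ¬? (u ≟ x) ×-dec ¬? (adj? G u x) ×-dec any? λ z → adj? G u z ×-dec adj? G x z

blind⇒¬resolver : ∀ {n} (G : Graph (Fin n)) (conn : Connected G) → Blind G →
                  ∀ {x} → ¬ Resolver G conn x
blind⇒¬resolver G conn blind {x} res with blind x
... | u , v , u≢v , inj₁ (ux , vx) = u≢v (resolver⇒degree≤1 G conn {x} res ux vx)
... | u , v , u≢v , inj₂ ((u≢x , ¬ux , _ , uz , xz) , v≢x , ¬vx , _ , vz , xz′) =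
  u≢v (res (trans (common⇒dist≡2 G conn {u} {x} u≢x ¬ux uz xz)
                  (sym (common⇒dist≡2 G conn {v} {x} v≢x ¬vx vz xz′))))

module _ {V W : Set} {G : Graph V} {H : Graph W} (iso : G ≅ H) where
  open _≅_ iso
  open Inverse bijection public using () renaming (to to φ; from to ψ)

  φψ : ∀ x → φ (ψ x) ≡ x
  φψ = Inverse.strictlyInverseˡ bijection

  ψφ : ∀ u → ψ (φ u) ≡ u
  ψφ = Inverse.strictlyInverseʳ bijection

  ψ-injective : Injective _≡_ _≡_ ψ
  ψ-injective {x} {y} eq = trans (sym (φψ x)) (trans (cong φ eq) (φψ y))

  ψ-adj : ∀ {x y} → Adj H x y → Adj G (ψ x) (ψ y)
  ψ-adj {x} {y} xy = Equivalence.from (adj-iff (ψ x) (ψ y))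
    (subst₂ (Adj H) (sym (φψ x)) (sym (φψ y)) xy)

  ψ-adj⁻ : ∀ {x y} → Adj G (ψ x) (ψ y) → Adj H x y
  ψ-adj⁻ {x} {y} xy = subst₂ (Adj H) (φψ x) (φψ y) (Equivalence.to (adj-iff (ψ x) (ψ y)) xy)

blind-≅ : ∀ {m n} {G : Graph (Fin n)} {H : Graph (Fin m)} → G ≅ H → Blind H → Blind G
blind-≅ {G = G} {H} iso blind x with blind (φ iso x)
... | u , v , u≢v , inj₁ (ux , vx) = ψ iso u , ψ iso v , u≢v ∘ ψ-injective iso ,
  inj₁ (back ux , back vx)
  where
  back : ∀ {u} → Adj H u (φ iso x) → Adj G (ψ iso u) x
  back ux = subst (Adj G _) (ψφ iso x) (ψ-adj iso ux)
... | u , v , u≢v , inj₂ (ux , vx) = ψ iso u , ψ iso v , u≢v ∘ ψ-injective iso ,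
  inj₂ (back ux , back vx)
  where
  back : ∀ {u} → TwoApart H u (φ iso x) → TwoApart G (ψ iso u) x
  back {u} (u≢x , ¬ux , z , uz , xz) = subst (TwoApart G (ψ iso u)) (ψφ iso x)
    (u≢x ∘ ψ-injective iso , ¬ux ∘ ψ-adj⁻ iso , ψ iso z , ψ-adj iso uz , ψ-adj iso xz)

complement-≅ : ∀ {m n} {G : Graph (Fin n)} {H : Graph (Fin m)} → G ≅ H → complement G ≅ complement H
complement-≅ iso = record
  { bijection = bijection
  ; adj-iff = λ u v → mk⇔
      (λ (u≢v , ¬uv) → (λ eq → u≢v (trans (sym (ψφ iso u)) (trans (cong (ψ iso) eq) (ψφ iso v))))
                     , ¬uv ∘ Equivalence.from (adj-iff u v))
      (λ (fu≢fv , ¬fufv) → fu≢fv ∘ cong (φ iso) , ¬fufv ∘ Equivalence.to (adj-iff u v))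
  }
  where open _≅_ iso

blind-C5 : Blind (C 5) × Blind (complement (C 5))
blind-C5 = from-yes (blind? (C 5)) , from-yes (blind? (complement (C 5)))

blind-B : Blind Defs.B × Blind (complement Defs.B)
blind-B = from-yes (blind? Defs.B) , from-yes (blind? (complement Defs.B))

-- The families Ω₂ and Ω₃

suc∣p-x∣≡∣p∣ : ∀ {n} {p : Subset n} {x} → x ∈ p → suc ∣ p - x ∣ ≡ ∣ p ∣
suc∣p-x∣≡∣p∣ {p = _ ∷ p} here = cong (suc ∘ ∣_∣) (p─⊥≡p p)
suc∣p-x∣≡∣p∣ {p = inside  ∷ p} (there x∈p) = cong suc (suc∣p-x∣≡∣p∣ x∈p)
suc∣p-x∣≡∣p∣ {p = outside ∷ p} (there x∈p) = suc∣p-x∣≡∣p∣ x∈p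

y∈p-x⇒y≢x : ∀ {n} {p : Subset n} {x y} → y ∈ p - x → y ≢ x
y∈p-x⇒y≢x {p = _ ∷ _} {zero}  {zero}  ()
y∈p-x⇒y≢x {p = _ ∷ _} {suc x} {suc y} (there y∈) refl = y∈p-x⇒y≢x y∈ refl

-- The vertices other than b and d, split by `R`. The form of `size` is the one that `Ω₃` asks for.
record Halves {n} (b d : Fin n) (R : Fin n → Set) : Set where
  field
    r s   : ℕ
    e     : Fin r → Fin n
    f     : Fin s → Fin n
    e-inj : Injective _≡_ _≡_ e
    f-inj : Injective _≡_ _≡_ f
    e≢b   : ∀ i → e i ≢ b
    e≢d   : ∀ i → e i ≢ d
    e-R   : ∀ i → R (e i)
    f≢b   : ∀ j → f j ≢ b
    f≢d   : ∀ j → f j ≢ d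
    f-¬R  : ∀ j → ¬ R (f j)
    e-sur : ∀ {v} → v ≢ b → v ≢ d → R v → ∃ λ i → e i ≡ v
    f-sur : ∀ {v} → v ≢ b → v ≢ d → ¬ R v → ∃ λ j → f j ≡ v
    size  : s ≡ n ∸ r ∸ 2

halves : ∀ {n} {b d : Fin n} → b ≢ d → {R : Fin n → Set} → (∀ v → Dec (R v)) → Halves b d R
halves {n} {b} {d} b≢d {R} R? = record
  { r = ∣ p ∣ ; s = ∣ q ∣ ; e = enum p ; f = enum q
  ; e-inj = enum-injective p ; f-inj = enum-injective q
  ; e≢b = proj₁ ∘ p-∈ ; e≢d = proj₁ ∘ proj₂ ∘ p-∈ ; e-R = proj₂ ∘ proj₂ ∘ p-∈
  ; f≢b = proj₁ ∘ q-∈ ; f≢d = proj₁ ∘ proj₂ ∘ q-∈ ; f-¬R = proj₂ ∘ proj₂ ∘ q-∈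
  ; e-sur = λ v≢b v≢d Rv → enum-surjective p (∈-select⁺ P? (v≢b , v≢d , Rv))
  ; f-sur = λ v≢b v≢d ¬Rv → enum-surjective q
      (x∈p∧x≢y⇒x∈p-y (x∈p∧x≢y⇒x∈p-y (x∉p⇒x∈∁p (¬Rv ∘ proj₂ ∘ proj₂ ∘ ∈-select⁻ P?)) v≢b) v≢d)
  ; size = trans (cong (_∸ 2) two-more) (cong (_∸ 2) (∣∁p∣≡n∸∣p∣ p))
  }
  where
  P? : ∀ v → Dec (v ≢ b × v ≢ d × R v)
  P? v = ¬? (v ≟ b) ×-dec ¬? (v ≟ d) ×-dec R? v
  p q : Subset n
  p = select P?
  q = ∁ p - b - d
  p-∈ : ∀ i → enum p i ≢ b × enum p i ≢ d × R (enum p i)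
  p-∈ i = ∈-select⁻ P? (enum-∈ p i)
  q-∈ : ∀ j → enum q j ≢ b × enum q j ≢ d × ¬ R (enum q j)
  q-∈ j = v≢b , v≢d , λ Rv → x∈∁p⇒x∉p (p─q⊆p _ _ (p─q⊆p _ _ v∈)) (∈-select⁺ P? (v≢b , v≢d , Rv))
    where
    v∈ = enum-∈ q j
    v≢d = y∈p-x⇒y≢x v∈
    v≢b = y∈p-x⇒y≢x {p = ∁ p} (p─q⊆p _ _ v∈)
  two-more : 2 + ∣ q ∣ ≡ ∣ ∁ p ∣
  two-more = trans
    (cong suc (suc∣p-x∣≡∣p∣ {p = ∁ p - b} (x∈p∧x≢y⇒x∈p-y
      (x∉p⇒x∈∁p λ d∈ → proj₁ (proj₂ (∈-select⁻ P? d∈)) refl) (≢-sym b≢d))))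
    (suc∣p-x∣≡∣p∣ {p = ∁ p} (x∉p⇒x∈∁p λ b∈ → proj₁ (∈-select⁻ P? b∈) refl))

-- If every choice of one vertex per class is an induced path, all relations between different
-- classes are settled. `rep` fills the classes not under comparison.
layout⇒≅ : ∀ {n} {G : Graph (Fin n)} (H : Fin 4 → FinGraph) (w : ∀ l → Fin (proj₁ (H l)) → Fin n) →
           (∀ l → Fin (proj₁ (H l))) →
           (∀ a b c d → InducedP₄ G (w 0F a) (w 1F b) (w 2F c) (w 3F d)) →
           (∀ l → Injective _≡_ _≡_ (w l)) → (∀ v → ∃₂ λ l i → w l i ≡ v) →
           (∀ l i j → Adj (proj₂ (H l)) i j ⇔ Adj G (w l i) (w l j)) → G ≅ replaceAll (P 4) H
layout⇒≅ {G = G} H w rep path w-inj cover inner⇔ =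
  placement⇒≅ w′ w′-inj (λ v → let l , i , eq = cover v in (l , i) , eq)
  (λ x y → mk⇔ forth (back x y))
  where
  w′ : ReplacedVertex (P 4) H → Fin _
  w′ (l , i) = w l i
  r₀ = rep 0F
  r₁ = rep 1F
  r₂ = rep 2F
  r₃ = rep 3F
  open InducedP₄
  forth : ∀ {x y} → ReplacedAdj (P 4) H x y → Adj G (w′ x) (w′ y)
  forth (inner {l} {i} {j} ij) = Equivalence.to (inner⇔ l i j) ij
  forth {0F , _} {0F , _} (outer e) = contradiction e (irrefl (P 4) {0F} refl)
  forth {0F , i} {1F , j} (outer _) = ab (path i j r₂ r₃)
  forth {0F , _} {2F , _} (outer e) = contradiction e (from-yes (¬? (adj? (P 4) 0F 2F)))
  forth {0F , _} {3F , _} (outer e) = contradiction e (from-yes (¬? (adj? (P 4) 0F 3F)))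
  forth {1F , i} {0F , j} (outer _) = symm G (ab (path j i r₂ r₃))
  forth {1F , _} {1F , _} (outer e) = contradiction e (irrefl (P 4) {1F} refl)
  forth {1F , i} {2F , j} (outer _) = bc (path r₀ i j r₃)
  forth {1F , _} {3F , _} (outer e) = contradiction e (from-yes (¬? (adj? (P 4) 1F 3F)))
  forth {2F , _} {0F , _} (outer e) = contradiction e (from-yes (¬? (adj? (P 4) 2F 0F)))
  forth {2F , i} {1F , j} (outer _) = symm G (bc (path r₀ j i r₃))
  forth {2F , _} {2F , _} (outer e) = contradiction e (irrefl (P 4) {2F} refl)
  forth {2F , i} {3F , j} (outer _) = cd (path r₀ r₁ i j)
  forth {3F , _} {0F , _} (outer e) = contradiction e (from-yes (¬? (adj? (P 4) 3F 0F)))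
  forth {3F , _} {1F , _} (outer e) = contradiction e (from-yes (¬? (adj? (P 4) 3F 1F)))
  forth {3F , i} {2F , j} (outer _) = symm G (cd (path r₀ r₁ j i))
  forth {3F , _} {3F , _} (outer e) = contradiction e (irrefl (P 4) {3F} refl)
  back : ∀ x y → Adj G (w′ x) (w′ y) → ReplacedAdj (P 4) H x y
  back (0F , i) (0F , j) ij = inner (Equivalence.from (inner⇔ 0F i j) ij)
  back (0F , _) (1F , _) _ = outer (from-yes (adj? (P 4) 0F 1F))
  back (0F , i) (2F , j) ij = contradiction ij (¬ac (path i r₁ j r₃))
  back (0F , i) (3F , j) ij = contradiction ij (¬ad (path i r₁ r₂ j))
  back (1F , _) (0F , _) _ = outer (from-yes (adj? (P 4) 1F 0F))
  back (1F , i) (1F , j) ij = inner (Equivalence.from (inner⇔ 1F i j) ij)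
  back (1F , _) (2F , _) _ = outer (from-yes (adj? (P 4) 1F 2F))
  back (1F , i) (3F , j) ij = contradiction ij (¬bd (path r₀ i r₂ j))
  back (2F , i) (0F , j) ij = contradiction (symm G ij) (¬ac (path j r₁ i r₃))
  back (2F , _) (1F , _) _ = outer (from-yes (adj? (P 4) 2F 1F))
  back (2F , i) (2F , j) ij = inner (Equivalence.from (inner⇔ 2F i j) ij)
  back (2F , _) (3F , _) _ = outer (from-yes (adj? (P 4) 2F 3F))
  back (3F , i) (0F , j) ij = contradiction (symm G ij) (¬ad (path j r₁ r₂ i))
  back (3F , i) (1F , j) ij = contradiction (symm G ij) (¬bd (path r₀ j r₂ i))
  back (3F , _) (2F , _) _ = outer (from-yes (adj? (P 4) 3F 2F))
  back (3F , i) (3F , j) ij = inner (Equivalence.from (inner⇔ 3F i j) ij)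
  w′-inj : Injective _≡_ _≡_ w′
  w′-inj {0F , _} {0F , _} eq = cong (0F ,_) (w-inj 0F eq)
  w′-inj {0F , i} {1F , j} eq = contradiction eq (a≢b (path i j r₂ r₃))
  w′-inj {0F , i} {2F , j} eq = contradiction eq (a≢c (path i r₁ j r₃))
  w′-inj {0F , i} {3F , j} eq = contradiction eq (a≢d (path i r₁ r₂ j))
  w′-inj {1F , i} {0F , j} eq = contradiction (sym eq) (a≢b (path j i r₂ r₃))
  w′-inj {1F , _} {1F , _} eq = cong (1F ,_) (w-inj 1F eq)
  w′-inj {1F , i} {2F , j} eq = contradiction eq (b≢c (path r₀ i j r₃))
  w′-inj {1F , i} {3F , j} eq = contradiction eq (b≢d (path r₀ i r₂ j))
  w′-inj {2F , i} {0F , j} eq = contradiction (sym eq) (a≢c (path j r₁ i r₃))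
  w′-inj {2F , i} {1F , j} eq = contradiction (sym eq) (b≢c (path r₀ j i r₃))
  w′-inj {2F , _} {2F , _} eq = cong (2F ,_) (w-inj 2F eq)
  w′-inj {2F , i} {3F , j} eq = contradiction eq (c≢d (path r₀ r₁ i j))
  w′-inj {3F , i} {0F , j} eq = contradiction (sym eq) (a≢d (path j r₁ r₂ i))
  w′-inj {3F , i} {1F , j} eq = contradiction (sym eq) (b≢d (path r₀ j r₂ i))
  w′-inj {3F , i} {2F , j} eq = contradiction (sym eq) (c≢d (path r₀ r₁ j i))
  w′-inj {3F , _} {3F , _} eq = cong (3F ,_) (w-inj 3F eq)

Fin1-≡ : (i j : Fin 1) → i ≡ j
Fin1-≡ 0F 0F = refl

inhabited⇒1≤ : ∀ {m} → Fin m → 1 ≤ m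
inhabited⇒1≤ {suc _} _ = s≤s z≤n

1≤n∸r∸2⇒r≤n∸3 : ∀ n r → 1 ≤ n ∸ r ∸ 2 → r ≤ n ∸ 3
1≤n∸r∸2⇒r≤n∸3 n r pos = ℕ.m+n≤o⇒m≤o∸n r (subst (_≤ n) (sym (ℕ.+-suc r 2))
  (ℕ.≰⇒> λ n≤r+2 → ℕ.<⇒≢ pos (sym (trans (ℕ.∸-+-assoc n r 2) (ℕ.m≤n⇒m∸n≡0 n≤r+2)))))

r≤n∸3⇒1≤n∸r∸2 : ∀ n r → 4 ≤ n → r ≤ n ∸ 3 → 1 ≤ n ∸ r ∸ 2
r≤n∸3⇒1≤n∸r∸2 n r n≥4 r≤ = subst (1 ≤_) (sym (ℕ.∸-+-assoc n r 2))
  (ℕ.m<n⇒0<n∸m (subst (_≤ n) (ℕ.+-suc r 2)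
    (subst (r + 3 ≤_) (ℕ.m∸n+n≡m (ℕ.≤-trans (s≤s (s≤s (s≤s z≤n))) n≥4)) (ℕ.+-monoˡ-≤ 3 r≤))))

-- b and d become the vertices 2 and 4; the others go to 1 or 3 according to whether they miss or
-- meet d.
blowup⇒Ω₃ : ∀ {n} {G : Graph (Fin n)} → Blowup G → Ω₃ G
blowup⇒Ω₃ {n} {G} (b , d , star , a , c , p) = inj₂ (r , inhabited⇒1≤ i₀ ,
  1≤n∸r∸2⇒r≤n∸3 n r (subst (1 ≤_) size (inhabited⇒1≤ j₀)) ,
  subst (λ s → G ≅ P 4 [ K̄ r ⟨ 0F ⟩, K̄ s ⟨ 2F ⟩]) size iso)
  where
  open Star star
  open Halves (halves distinct (λ v → ¬? (adj? G v d)))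
  i₀ : Fin r
  i₀ = proj₁ (e-sur (a≢b p) (a≢d p) (InducedP₄.¬ad p))
  j₀ : Fin s
  j₀ = proj₁ (f-sur (≢-sym (b≢c p)) (c≢d p) (λ ¬cd → ¬cd (InducedP₄.cd p)))
  w : ∀ l → Fin (proj₁ (at₂ 0F (K̄ r) 2F (K̄ s) l)) → Fin n
  w 0F = e
  w 1F _ = b
  w 2F = f
  w 3F _ = d
  w (suc (suc (suc (suc ()))))
  iso : G ≅ P 4 [ K̄ r ⟨ 0F ⟩, K̄ s ⟨ 2F ⟩]
  iso = layout⇒≅ (at₂ 0F (K̄ r) 2F (K̄ s)) w (λ { 0F → i₀ ; 1F → 0F ; 2F → j₀ ; 3F → 0F })
    (λ i _ j _ → p₄ (hub (e≢b i) (e≢d i)) (symm G (hub (f≢b j) (f≢d j)))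
       (decidable-stable (adj? G (f j) d) (f-¬R j))
       (indep (e≢b i) (e≢d i) (f≢b j) (f≢d j)) (e-R i) nonadj)
    (λ { 0F → e-inj ; 1F _ → Fin1-≡ _ _ ; 2F → f-inj ; 3F _ → Fin1-≡ _ _ })
    cover
    (λ { 0F i j → mk⇔ (λ ()) (indep (e≢b i) (e≢d i) (e≢b j) (e≢d j))
       ; 1F i j → mk⇔ (contradiction (Fin1-≡ i j)) (⊥-elim ∘ irrefl G refl)
       ; 2F i j → mk⇔ (λ ()) (indep (f≢b i) (f≢d i) (f≢b j) (f≢d j))
       ; 3F i j → mk⇔ (contradiction (Fin1-≡ i j)) (⊥-elim ∘ irrefl G refl) })
    where
    cover : ∀ v → ∃₂ λ l i → w l i ≡ v
    cover v with v ≟ b | v ≟ d | adj? G v d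
    ... | yes refl | _        | _      = 1F , 0F , refl
    ... | no _     | yes refl | _      = 3F , 0F , refl
    ... | no v≢b   | no v≢d   | yes vd = 2F , f-sur v≢b v≢d (λ ¬vd → ¬vd vd)
    ... | no v≢b   | no v≢d   | no ¬vd = 0F , e-sur v≢b v≢d ¬vd

-- d and b become the vertices 3 and 4; the neighbours of d in `B` form the clique at 1, apart from
-- b and d the rest form the clique at 2.
blowup-opposite⇒Ω₃ : ∀ {n} {A B : Graph (Fin n)} → Opposite A B → Blowup B → Ω₃ A
blowup-opposite⇒Ω₃ {n} {A} {B} opp (b , d , star , a , c , p) = inj₁ (r , inhabited⇒1≤ i₀ ,
  1≤n∸r∸2⇒r≤n∸3 n r (subst (1 ≤_) size (inhabited⇒1≤ j₀)) ,
  subst (λ s → A ≅ P 4 [ K r ⟨ 0F ⟩, K s ⟨ 1F ⟩]) size iso)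
  where
  open Star star
  open Halves (halves distinct (λ v → adj? B v d))
  opp′ = opposite-sym opp
  i₀ : Fin r
  i₀ = proj₁ (e-sur (≢-sym (b≢c p)) (c≢d p) (InducedP₄.cd p))
  j₀ : Fin s
  j₀ = proj₁ (f-sur (a≢b p) (a≢d p) (InducedP₄.¬ad p))
  w : ∀ l → Fin (proj₁ (at₂ 0F (K r) 1F (K s) l)) → Fin n
  w 0F = e
  w 1F = f
  w 2F _ = d
  w 3F _ = b
  w (suc (suc (suc (suc ()))))
  iso : A ≅ P 4 [ K r ⟨ 0F ⟩, K s ⟨ 1F ⟩]
  iso = layout⇒≅ (at₂ 0F (K r) 1F (K s)) w (λ { 0F → i₀ ; 1F → j₀ ; 2F → 0F ; 3F → 0F })
    (λ i j _ _ → reverse (opposite-P₄ opp′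
       (p₄ (hub (f≢b j) (f≢d j)) (symm B (hub (e≢b i) (e≢d i))) (e-R i)
           (indep (f≢b j) (f≢d j) (e≢b i) (e≢d i)) (f-¬R j) nonadj)))
    (λ { 0F → e-inj ; 1F → f-inj ; 2F _ → Fin1-≡ _ _ ; 3F _ → Fin1-≡ _ _ })
    cover
    (λ { 0F i j → mk⇔ (λ i≢j → Opposite.to opp′ (i≢j ∘ e-inj)
                                              (indep (e≢b i) (e≢d i) (e≢b j) (e≢d j)))
                      (λ ij → adj⇒≢ A ij ∘ cong e)
       ; 1F i j → mk⇔ (λ i≢j → Opposite.to opp′ (i≢j ∘ f-inj)
                                              (indep (f≢b i) (f≢d i) (f≢b j) (f≢d j)))
                      (λ ij → adj⇒≢ A ij ∘ cong f)
       ; 2F i j → mk⇔ (contradiction (Fin1-≡ i j)) (⊥-elim ∘ irrefl A refl)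
       ; 3F i j → mk⇔ (contradiction (Fin1-≡ i j)) (⊥-elim ∘ irrefl A refl) })
    where
    cover : ∀ v → ∃₂ λ l i → w l i ≡ v
    cover v with v ≟ b | v ≟ d | adj? B v d
    ... | yes refl | _        | _      = 3F , 0F , refl
    ... | no _     | yes refl | _      = 2F , 0F , refl
    ... | no v≢b   | no v≢d   | yes vd = 0F , e-sur v≢b v≢d vd
    ... | no v≢b   | no v≢d   | no ¬vd = 1F , f-sur v≢b v≢d ¬vd

twoClasses⇒star : ∀ {V : Set} {G : Graph V} {I J : Set} (u : I → V) (v : J → V) {b d : V} → I → J →
                  (∀ i j → InducedP₄ G (u i) b (v j) d) →
                  (∀ i i′ → ¬ Adj G (u i) (u i′)) → (∀ j j′ → ¬ Adj G (v j) (v j′)) →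
                  (∀ x → x ≢ b → x ≢ d → (∃ λ i → u i ≡ x) ⊎ (∃ λ j → v j ≡ x)) → Star G b d
twoClasses⇒star {G = G} u v {b} {d} i₀ j₀ path ¬uu ¬vv cover = record
  { distinct = b≢d (path i₀ j₀)
  ; nonadj = InducedP₄.¬bd (path i₀ j₀)
  ; hub = λ x≢b x≢d → hub (cover _ x≢b x≢d)
  ; indep = λ x≢b x≢d y≢b y≢d → indep (cover _ x≢b x≢d) (cover _ y≢b y≢d)
  }
  where
  hub : ∀ {x} → (∃ λ i → u i ≡ x) ⊎ (∃ λ j → v j ≡ x) → Adj G x b
  hub (inj₁ (i , refl)) = InducedP₄.ab (path i j₀)
  hub (inj₂ (j , refl)) = symm G (InducedP₄.bc (path i₀ j))
  indep : ∀ {x y} → (∃ λ i → u i ≡ x) ⊎ (∃ λ j → v j ≡ x) →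
          (∃ λ i → u i ≡ y) ⊎ (∃ λ j → v j ≡ y) → ¬ Adj G x y
  indep (inj₁ (i , refl)) (inj₁ (i′ , refl)) = ¬uu i i′
  indep (inj₁ (i , refl)) (inj₂ (j , refl))  = InducedP₄.¬ac (path i j)
  indep (inj₂ (j , refl)) (inj₁ (i , refl))  = InducedP₄.¬ac (path i j) ∘ symm G
  indep (inj₂ (j , refl)) (inj₂ (j′ , refl)) = ¬vv j j′

module _ {n} {G : Graph (Fin n)} {H : Fin 4 → FinGraph} (iso : G ≅ replaceAll (P 4) H) where

  at-class : ∀ l → Fin (proj₁ (H l)) → Fin n
  at-class l i = ψ iso (l , i)

  class-path : ∀ a b c d →
               InducedP₄ G (at-class 0F a) (at-class 1F b) (at-class 2F c) (at-class 3F d)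
  class-path a b c d = p₄
    (ψ-adj iso (outer (from-yes (adj? (P 4) 0F 1F))))
    (ψ-adj iso (outer (from-yes (adj? (P 4) 1F 2F))))
    (ψ-adj iso (outer (from-yes (adj? (P 4) 2F 3F))))
    (apart (λ ()) (from-yes (¬? (adj? (P 4) 0F 2F))))
    (apart (λ ()) (from-yes (¬? (adj? (P 4) 0F 3F))))
    (apart (λ ()) (from-yes (¬? (adj? (P 4) 1F 3F))))
    where
    apart : ∀ {k l i j} → k ≢ l → ¬ Adj (P 4) k l → ¬ Adj G (at-class k i) (at-class l j)
    apart k≢l ¬kl adj with ψ-adj⁻ iso adj
    ... | outer kl = ¬kl kl
    ... | inner _  = k≢l refl

  class-adj : ∀ {l i j} → Adj (proj₂ (H l)) i j → Adj G (at-class l i) (at-class l j)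
  class-adj ij = ψ-adj iso (inner ij)

  class-adj⁻ : ∀ {l i j} → Adj G (at-class l i) (at-class l j) → Adj (proj₂ (H l)) i j
  class-adj⁻ {l} adj with ψ-adj⁻ iso adj
  ... | outer ll = contradiction ll (irrefl (P 4) {l} refl)
  ... | inner ij = ij

  class-≢ : ∀ {l i j} → at-class l i ≢ at-class l j → i ≢ j
  class-≢ ≢ refl = ≢ refl

  cover : ∀ x → ∃₂ λ l i → at-class l i ≡ x
  cover x = proj₁ (φ iso x) , proj₂ (φ iso x) , ψφ iso x

  module _ (rep : ∀ l → Fin (proj₁ (H l))) where

    Single : Fin 4 → Set
    Single l = ∀ i → i ≡ rep l

    coverBut : ∀ {k l k′ l′} → (∀ m → m ≡ k ⊎ m ≡ l ⊎ m ≡ k′ ⊎ m ≡ l′) → Single k′ → Single l′ →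
               ∀ x → x ≢ at-class k′ (rep k′) → x ≢ at-class l′ (rep l′) →
               (∃ λ i → at-class k i ≡ x) ⊎ (∃ λ j → at-class l j ≡ x)
    coverBut split s s′ x x≢ x≢′ with cover x
    ... | m , i , eq with split m
    ...   | inj₁ refl               = inj₁ (i , eq)
    ...   | inj₂ (inj₁ refl)        = inj₂ (i , eq)
    ...   | inj₂ (inj₂ (inj₁ refl)) = contradiction (trans (sym eq) (cong (at-class m) (s i))) x≢
    ...   | inj₂ (inj₂ (inj₂ refl)) = contradiction (trans (sym eq) (cong (at-class m) (s′ i))) x≢′

    edgeless⇒star : (∀ l i j → ¬ Adj (proj₂ (H l)) i j) → Single 1F → Single 3F →
                    Star G (at-class 1F (rep 1F)) (at-class 3F (rep 3F))
    edgeless⇒star edgeless s₁ s₃ = twoClasses⇒star (at-class 0F) (at-class 2F) (rep 0F) (rep 2F)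
      (λ i j → class-path i (rep 1F) j (rep 3F))
      (λ i j → edgeless 0F i j ∘ class-adj⁻) (λ i j → edgeless 2F i j ∘ class-adj⁻)
      (coverBut (λ { 0F → inj₁ refl ; 1F → inj₂ (inj₂ (inj₁ refl))
                   ; 2F → inj₂ (inj₁ refl) ; 3F → inj₂ (inj₂ (inj₂ refl)) }) s₁ s₃)

    -- For an edgeless graph put at vertex 2: reversing the path moves it to position 3, where the
    -- star has its second class.
    edgeless⇒starʳ : (∀ l i j → ¬ Adj (proj₂ (H l)) i j) → Single 2F → Single 0F →
                     Star G (at-class 2F (rep 2F)) (at-class 0F (rep 0F))
    edgeless⇒starʳ edgeless s₂ s₀ = twoClasses⇒star (at-class 3F) (at-class 1F) (rep 3F) (rep 1F)
      (λ i j → reverse (class-path (rep 0F) j (rep 2F) i))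
      (λ i j → edgeless 3F i j ∘ class-adj⁻) (λ i j → edgeless 1F i j ∘ class-adj⁻)
      (coverBut (λ { 0F → inj₂ (inj₂ (inj₂ refl)) ; 1F → inj₂ (inj₁ refl)
                   ; 2F → inj₂ (inj₂ (inj₁ refl)) ; 3F → inj₁ refl }) s₂ s₀)

    -- In the complement 1 - 2 - 3 - 4 reads 2 - 4 - 1 - 3, so the cliques at 2 and 1 turn into the
    -- independent classes around the hub 4.
    complete⇒star : (∀ l i j → i ≢ j → Adj (proj₂ (H l)) i j) → Single 3F → Single 2F →
                    Star (complement G) (at-class 3F (rep 3F)) (at-class 2F (rep 2F))
    complete⇒star complete s₃ s₂ = twoClasses⇒star (at-class 1F) (at-class 0F) (rep 1F) (rep 0F)
      (λ i j → opposite-P₄ (complement-opposite G) (class-path j i (rep 2F) (rep 3F)))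
      (clique 1F) (clique 0F)
      (coverBut (λ { 0F → inj₂ (inj₁ refl) ; 1F → inj₁ refl
                   ; 2F → inj₂ (inj₂ (inj₂ refl)) ; 3F → inj₂ (inj₂ (inj₁ refl)) }) s₃ s₂)
      where
      clique : ∀ l i j → ¬ Adj (complement G) (at-class l i) (at-class l j)
      clique l i j (≢ , ¬ij) = ¬ij (class-adj (complete l i j (class-≢ ≢)))

Starlike : ∀ {n} → Graph (Fin n) → Set
Starlike G = ∃₂ λ b d → Star G b d ⊎ Star (complement G) b d

K1-edgeless : ∀ i j → ¬ Adj (K 1) i j
K1-edgeless i j i≢j = i≢j (Fin1-≡ i j)

-- A member of `Ω₂` is handled as a blow-up in which one of the two classes is a single vertex.
Ω⇒starlike : ∀ {n} {G : Graph (Fin n)} → 4 ≤ n → Ω₂ G ⊎ Ω₃ G → Starlike G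
Ω⇒starlike {n} n≥4 = λ
  { (inj₁ (inj₁ iso)) → _ , _ , inj₂ (complete⇒star iso
      (λ { 0F → i₀ ; 1F → 0F ; 2F → 0F ; 3F → 0F })
      (λ { 0F _ _ → id ; 1F _ _ → id ; 2F _ _ → id ; 3F _ _ → id }) only only)
  ; (inj₁ (inj₂ (inj₁ iso))) → _ , _ , inj₁ (edgeless⇒star iso
      (λ { 0F → i₀ ; 1F → 0F ; 2F → 0F ; 3F → 0F })
      (λ { 0F _ _ → id ; 1F → K1-edgeless ; 2F → K1-edgeless ; 3F → K1-edgeless }) only only)
  ; (inj₁ (inj₂ (inj₂ (inj₁ iso)))) → _ , _ , inj₂ (complete⇒star iso
      (λ { 0F → 0F ; 1F → i₀ ; 2F → 0F ; 3F → 0F })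
      (λ { 0F _ _ → id ; 1F _ _ → id ; 2F _ _ → id ; 3F _ _ → id }) only only)
  ; (inj₁ (inj₂ (inj₂ (inj₂ iso)))) → _ , _ , inj₁ (edgeless⇒starʳ iso
      (λ { 0F → 0F ; 1F → i₀ ; 2F → 0F ; 3F → 0F })
      (λ { 0F → K1-edgeless ; 1F _ _ → id ; 2F → K1-edgeless ; 3F → K1-edgeless }) only only)
  ; (inj₂ (inj₁ (r , r≥1 , r≤ , iso))) → _ , _ , inj₂ (complete⇒star iso
      (λ { 0F → fromℕ< r≥1 ; 1F → fromℕ< (r≤n∸3⇒1≤n∸r∸2 n r n≥4 r≤) ; 2F → 0F ; 3F → 0F })
      (λ { 0F _ _ → id ; 1F _ _ → id ; 2F _ _ → id ; 3F _ _ → id }) only only)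
  ; (inj₂ (inj₂ (r , r≥1 , r≤ , iso))) → _ , _ , inj₁ (edgeless⇒star iso
      (λ { 0F → fromℕ< r≥1 ; 1F → 0F ; 2F → fromℕ< (r≤n∸3⇒1≤n∸r∸2 n r n≥4 r≤) ; 3F → 0F })
      (λ { 0F _ _ → id ; 1F → K1-edgeless ; 2F _ _ → id ; 3F → K1-edgeless }) only only)
  }
  where
  i₀ : Fin (n ∸ 3)
  i₀ = fromℕ< (ℕ.m+n≤o⇒m≤o∸n 1 n≥4)
  only : (i : Fin 1) → i ≡ 0F
  only i = Fin1-≡ i 0F

-- Arithmetic of the bounds and assembly

x+3≤n⇒x+y≤2n∸6 : ∀ {n x y} → x + 3 ≤ n → y + 3 ≤ n → x + y ≤ 2 * n ∸ 6
x+3≤n⇒x+y≤2n∸6 {n} {x} {y} x≤ y≤ = ℕ.m+n≤o⇒m≤o∸n (x + y)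
  (subst₂ _≤_ (lhs x y) (rhs n) (ℕ.+-mono-≤ x≤ y≤))
  where
  lhs : ∀ x y → x + 3 + (y + 3) ≡ x + y + 6
  lhs = solve-∀
  rhs : ∀ n → n + n ≡ 2 * n
  rhs = solve-∀

-- As y is at most n - 3, x cannot be smaller than that. The bound `4 ≤ n` keeps the subtraction of
-- 6 from being truncated.
x+y≡2n∸6⇒n≤x+3 : ∀ {n x y} → 4 ≤ n → y + 3 ≤ n → x + y ≡ 2 * n ∸ 6 → n ≤ x + 3
x+y≡2n∸6⇒n≤x+3 {n} {x} {y} n≥4 y≤ eq = ℕ.+-cancelʳ-≤ n n (x + 3)
  (subst (_≤ x + 3 + n) (trans (lhs x y) (trans (cong (_+ 6) eq) (trans (ℕ.m∸n+n≡m 6≤2n) (rhs n))))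
    (ℕ.+-monoʳ-≤ (x + 3) y≤))
  where
  lhs : ∀ x y → x + 3 + (y + 3) ≡ x + y + 6
  lhs = solve-∀
  rhs : ∀ n → 2 * n ≡ n + n
  rhs = solve-∀
  6≤2n : 6 ≤ 2 * n
  6≤2n = ℕ.≤-trans (s≤s (s≤s (s≤s (s≤s (s≤s (s≤s z≤n)))))) (ℕ.*-monoʳ-≤ 2 n≥4)

x+3≡n⇒x+y≡2n∸6 : ∀ {n x y} → x + 3 ≡ n → y + 3 ≡ n → x + y ≡ 2 * n ∸ 6
x+3≡n⇒x+y≡2n∸6 {n} {x} {y} eq eq′ = trans (sym (ℕ.m+n∸n≡m (x + y) 6))
  (cong (_∸ 6) (trans (lhs x y) (trans (cong₂ _+_ eq eq′) (rhs n))))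
  where
  lhs : ∀ x y → x + y + 6 ≡ x + 3 + (y + 3)
  lhs = solve-∀
  rhs : ∀ n → n + n ≡ 2 * n
  rhs = solve-∀

x+y≡2⇒x≡1×y≡1 : ∀ {x y} → 1 ≤ x → 1 ≤ y → x + y ≡ 2 → x ≡ 1 × y ≡ 1
x+y≡2⇒x≡1×y≡1 {1} {1} _ _ _ = refl , refl
x+y≡2⇒x≡1×y≡1 {1} {suc (suc _)} _ _ ()
x+y≡2⇒x≡1×y≡1 {suc (suc x)} {suc y} _ _ eq =
  contradiction (trans (sym (ℕ.+-suc x y)) (ℕ.suc-injective (ℕ.suc-injective eq))) λ ()

x+3≤4⇒x≡1 : ∀ {x} → 1 ≤ x → x + 3 ≤ 4 → x ≡ 1
x+3≤4⇒x≡1 {x} x≥1 x+3≤4 = ℕ.≤-antisym (ℕ.+-cancelʳ-≤ 3 x 1 x+3≤4) x≥1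

module _ {n} (n≥4 : 4 ≤ n) (G : Graph (Fin n)) (dc : DoublyConnected G) where
  open DoublyConnected dc renaming (connected to cG; complement-connected to cḠ)

  private
    Ḡ : Graph (Fin n)
    Ḡ = complement G

    opp : Opposite G Ḡ
    opp = complement-opposite G

    n≥2 : 2 ≤ n
    n≥2 = ℕ.≤-trans (s≤s (s≤s z≤n)) n≥4

    sum : ℕ
    sum = β G cG + β Ḡ cḠ

    P₄-in-G : ∃ λ a → ∃ λ b → ∃ λ c → ∃ λ d → InducedP₄ G a b c d
    P₄-in-G = ∃-inducedP₄ n≥2 cG cḠ opp

  βG+3≤n : β G cG + 3 ≤ n
  βG+3≤n = P₄⇒β+3≤n G cG (proj₂ (proj₂ (proj₂ (proj₂ P₄-in-G))))

  βḠ+3≤n : β Ḡ cḠ + 3 ≤ n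
  βḠ+3≤n = P₄⇒β+3≤n Ḡ cḠ (opposite-P₄ opp (proj₂ (proj₂ (proj₂ (proj₂ P₄-in-G)))))

  βG≥1 : 1 ≤ β G cG
  βG≥1 = ℕ.n≢0⇒n>0 (β≢0 G cG n≥2)

  βḠ≥1 : 1 ≤ β Ḡ cḠ
  βḠ≥1 = ℕ.n≢0⇒n>0 (β≢0 Ḡ cḠ n≥2)

  bounds : 2 ≤ sum × sum ≤ 2 * n ∸ 6
  bounds = ℕ.+-mono-≤ βG≥1 βḠ≥1 , x+3≤n⇒x+y≤2n∸6 {n} {β G cG} {β Ḡ cḠ} βG+3≤n βḠ+3≤n

  sum≡2⇒≅P4 : sum ≡ 2 → G ≅ P 4
  sum≡2⇒≅P4 eq =
    let βG≡1 , βḠ≡1 = x+y≡2⇒x≡1×y≡1 βG≥1 βḠ≥1 eq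
        x , rx = β≡1⇒resolver G cG n≥2 βG≡1
        y , ry = β≡1⇒resolver Ḡ cḠ n≥2 βḠ≡1
    in P₄⇒≅P4 (proj₂ (proj₂ (proj₂ (proj₂ P₄-in-G)))) (resolvers⇒n≤4 cG cḠ opp {x} {y} rx ry)

  -- For n = 4 both numbers are squeezed between 1 and n - 3.
  n≡4⇒sum≡2 : n ≡ 4 → sum ≡ 2
  n≡4⇒sum≡2 n≡4 = cong₂ _+_
    (x+3≤4⇒x≡1 βG≥1 (subst (β G cG + 3 ≤_) n≡4 βG+3≤n))
    (x+3≤4⇒x≡1 βḠ≥1 (subst (β Ḡ cḠ + 3 ≤_) n≡4 βḠ+3≤n))

  ≅⇒order : ∀ {m} {H : Graph (Fin m)} → G ≅ H → n ≡ m
  ≅⇒order iso = ↔⇒≡ (_≅_.bijection iso)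

  ≅P4⇒sum≡2n∸6 : G ≅ P 4 → sum ≡ 2 * n ∸ 6
  ≅P4⇒sum≡2n∸6 iso = trans (n≡4⇒sum≡2 n≡4) (cong (λ k → 2 * k ∸ 6) (sym n≡4))
    where
    n≡4 = ≅⇒order iso

  -- For n = 5, n - 3 is 2, so excluding β = 1 is enough.
  blind⇒sum≡2n∸6 : n ≡ 5 → Blind G → Blind Ḡ → sum ≡ 2 * n ∸ 6
  blind⇒sum≡2n∸6 n≡5 blind blind′ = x+3≡n⇒x+y≡2n∸6 {n} {β G cG} {β Ḡ cḠ}
    (exact G cG βG≥1 βG+3≤n blind) (exact Ḡ cḠ βḠ≥1 βḠ+3≤n blind′)
    where
    exact : ∀ (H : Graph (Fin n)) (c : Connected H) → 1 ≤ β H c → β H c + 3 ≤ n → Blind H →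
            β H c + 3 ≡ n
    exact H c β≥1 β+3≤n blind = ℕ.≤-antisym β+3≤n (subst (_≤ β H c + 3) (sym n≡5) (ℕ.+-monoˡ-≤ 3
      (ℕ.≤∧≢⇒< β≥1 λ 1≡β →
        let x , res = β≡1⇒resolver H c n≥2 (sym 1≡β) in blind⇒¬resolver H c blind {x} res)))

  noneResolved⇒sum≡2n∸6 : NoneResolved G cG 4 → NoneResolved Ḡ cḠ 4 → sum ≡ 2 * n ∸ 6
  noneResolved⇒sum≡2n∸6 none none′ = x+3≡n⇒x+y≡2n∸6 {n} {β G cG} {β Ḡ cḠ}
    (exact G cG βG+3≤n none) (exact Ḡ cḠ βḠ+3≤n none′)
    where
    exact : ∀ (H : Graph (Fin n)) (c : Connected H) → β H c + 3 ≤ n → NoneResolved H c 4 →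
            β H c + 3 ≡ n
    exact H c β+3≤n none = ℕ.≤-antisym β+3≤n
      (ℕ.≤-pred (subst (n <_) (ℕ.+-suc (β H c) 3) (noneResolved⇒n<β+k H c none)))

  starlike⇒sum≡2n∸6 : Starlike G → sum ≡ 2 * n ∸ 6
  starlike⇒sum≡2n∸6 (_ , _ , inj₁ star) = noneResolved⇒sum≡2n∸6
    (star⇒noneResolved cG star) (star⇒noneResolved-opposite cG star cḠ opp)
  starlike⇒sum≡2n∸6 (_ , _ , inj₂ star) = noneResolved⇒sum≡2n∸6
    (star⇒noneResolved-opposite cḠ star cG (opposite-sym opp)) (star⇒noneResolved cḠ star)

  Ω⇒sum≡2n∸6 : Ω₁ G ⊎ Ω₂ G ⊎ Ω₃ G → sum ≡ 2 * n ∸ 6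
  Ω⇒sum≡2n∸6 (inj₁ (inj₁ iso)) = ≅P4⇒sum≡2n∸6 iso
  Ω⇒sum≡2n∸6 (inj₁ (inj₂ (inj₁ iso))) = blind⇒sum≡2n∸6 (≅⇒order iso)
    (blind-≅ iso (proj₁ blind-C5)) (blind-≅ (complement-≅ iso) (proj₂ blind-C5))
  Ω⇒sum≡2n∸6 (inj₁ (inj₂ (inj₂ iso))) = blind⇒sum≡2n∸6 (≅⇒order iso)
    (blind-≅ iso (proj₁ blind-B)) (blind-≅ (complement-≅ iso) (proj₂ blind-B))
  Ω⇒sum≡2n∸6 (inj₂ Ω₂₃) = starlike⇒sum≡2n∸6 (Ω⇒starlike n≥4 Ω₂₃)

  sum≡2n∸6⇒extremal : sum ≡ 2 * n ∸ 6 → Extremal G Ḡ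
  sum≡2n∸6⇒extremal eq = record
    { conn-A = cG ; conn-B = cḠ ; opposite = opp
    ; none-A = n<β+4⇒noneResolved G cG (above (β G cG)
        (x+y≡2n∸6⇒n≤x+3 {n} {β G cG} {β Ḡ cḠ} n≥4 βḠ+3≤n eq))
    ; none-B = n<β+4⇒noneResolved Ḡ cḠ (above (β Ḡ cḠ)
        (x+y≡2n∸6⇒n≤x+3 {n} {β Ḡ cḠ} {β G cG} n≥4 βG+3≤n (trans (ℕ.+-comm (β Ḡ cḠ) (β G cG)) eq)))
    }
    where
    above : ∀ x → n ≤ x + 3 → n < x + 4
    above x n≤ = subst (n <_) (sym (ℕ.+-suc x 3)) (s≤s n≤)

  sum≡2n∸6⇒Ω : sum ≡ 2 * n ∸ 6 → Ω₁ G ⊎ Ω₂ G ⊎ Ω₃ G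
  sum≡2n∸6⇒Ω eq with ℕ.m≤n⇒m<n∨m≡n n≥4
  -- With four vertices nothing lies outside the path, and part (i) already identifies the graph.
  ... | inj₂ 4≡n = inj₁ (inj₁ (sum≡2⇒≅P4 (n≡4⇒sum≡2 (sym 4≡n))))
  ... | inj₁ n≥5 with extremal⇒structure n≥5 (sum≡2n∸6⇒extremal eq)
  ...   | inj₁ (inj₁ ≅C5)       = inj₁ (inj₂ (inj₁ ≅C5))
  ...   | inj₁ (inj₂ ≅B)        = inj₁ (inj₂ (inj₂ ≅B))
  ...   | inj₂ (inj₁ blowup)    = inj₂ (inj₂ (blowup⇒Ω₃ blowup))
  ...   | inj₂ (inj₂ blowup)    = inj₂ (inj₂ (blowup-opposite⇒Ω₃ opp blowup))

theorem2 : ∀ (n : ℕ) → 4 ≤ n → (G : Graph (Fin n)) (dc : DoublyConnected G) →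
  let open DoublyConnected dc
      s = β G connected + β (complement G) complement-connected
  in (2 ≤ s × s ≤ 2 * n ∸ 6)
     × (s ≡ 2 ⇔ G ≅ P 4)
     × (s ≡ 2 * n ∸ 6 ⇔ (Ω₁ G ⊎ Ω₂ G ⊎ Ω₃ G))
theorem2 n n≥4 G dc =
    bounds n≥4 G dc
  , mk⇔ (sum≡2⇒≅P4 n≥4 G dc) (λ iso → n≡4⇒sum≡2 n≥4 G dc (≅⇒order n≥4 G dc iso))
  , mk⇔ (sum≡2n∸6⇒Ω n≥4 G dc) (Ω⇒sum≡2n∸6 n≥4 G dc)
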